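{- Let $a, b$ be integers with $1 \le a \le b$ and $a^2 \equiv a \bmod b$, let $M_{a,b} = \{n \in \mathbb{Z}_{\ge 1} : n \equiv a \bmod b\} \cup \{1\}$ be the corresponding arithmetic congruence monoid, and let $q = \gcd(a,b)$. Then the atomic density $\mathcal{D}(M_{a,b})$ satisfies $$\mathcal{D}(M_{a,b}) = \lim_{n \to \infty} \frac{|\mathcal{A}(M_{a,b}) \cap \{1, \ldots, n\}|}{|M_{a,b} \cap \{1, \ldots, n\}|} = 1 - \frac{1}{q}$$ (in particular, the limit exists).
   Context: For integers $a, b$ with $1 \le a \le b$ and $a^2 \equiv a \bmod b$, the set $M_{a,b} = \{n \in \mathbb{Z}_{\ge 1} : n \equiv a \bmod b\} \cup \{1\}$ is closed under multiplication, and is a multiplicative monoid called an arithmetic congruence monoid (ACM). Its only unit is $1$. A non-unit element $n \in M_{a,b}$ is an atom if it cannot be written as a product of two non-unit elements of $M_{a,b}$; $\mathcal{A}(M_{a,b})$ denotes the set of atoms of $M_{a,b}$. The atomic density of $M_{a,b}$ is $\mathcal{D}(M_{a,b}) = \lim_{n \to \infty} \frac{|\mathcal{A}(M_{a,b}) \cap \{1, \ldots, n\}|}{|M_{a,b} \cap \{1, \ldots, n\}|}$. -}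

module Defs where

open import Data.Integer.Base using (+_)
open import Data.List.Base using (length; filter; applyUpTo)
open import Data.List.Properties using (filter-some)
open import Data.List.Relation.Unary.Any using (here)
open import Data.Nat.Base
  using (ℕ; suc; _≤_; _*_; ∣_-_∣; NonZero; >-nonZero; ≢-nonZero; s≤s)
open import Data.Nat.Divisibility using (_∣_; _∣?_)
open import Data.Nat.GCD using (gcd; gcd[m,n]≢0)
open import Data.Nat.Properties
  using (_≟_; _≤?_; anyUpTo?; m*n≡1⇒m≡1; m≤m*n; m≤n*m; m<n⇒n≢0)
open import Data.Product.Base using (_×_; _,_; ∃-syntax)
open import Data.Rational.Base as ℚ using (ℚ; 0ℚ)
open import Data.Sum.Base using (_⊎_; inj₁; inj₂)
open import Level using (0ℓ)
open import Relation.Binary.PropositionalEquality using (_≡_; refl)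
open import Relation.Nullary.Decidable using (map′; ¬?; _×-dec_; _⊎-dec_)
open import Relation.Nullary.Negation using (¬_)
open import Relation.Unary using (Pred; Decidable)

infix 4 _≡_[mod_]

_≡_[mod_] : ℕ → ℕ → ℕ → Set
m ≡ n [mod d ] = d ∣ ∣ m - n ∣

-- For arbitrary a and b this is only a set of positive integers; it is a
-- multiplicative monoid when a * a ≡ a [mod b ].
M : ℕ → ℕ → Pred ℕ 0ℓ
M a b n = (1 ≤ n × n ≡ a [mod b ]) ⊎ n ≡ 1

-- Units of the monoid M a b, so the inverse must itself lie in M a b.
Unit : ℕ → ℕ → Pred ℕ 0ℓ
Unit a b u = M a b u × ∃[ v ] (M a b v × u * v ≡ 1)

NonUnit : ℕ → ℕ → Pred ℕ 0ℓ
NonUnit a b n = M a b n × ¬ Unit a b n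

Factors : ℕ → ℕ → Pred ℕ 0ℓ
Factors a b n = ∃[ x ] ∃[ y ] (NonUnit a b x × NonUnit a b y × n ≡ x * y)

Atom : ℕ → ℕ → Pred ℕ 0ℓ
Atom a b n = NonUnit a b n × ¬ Factors a b n

M? : ∀ a b → Decidable (M a b)
M? a b n = (1 ≤? n ×-dec b ∣? ∣ n - a ∣) ⊎-dec n ≟ 1

M⇒nonZero : ∀ {a b n} → M a b n → NonZero n
M⇒nonZero (inj₁ (1≤n , _)) = >-nonZero 1≤n
M⇒nonZero (inj₂ refl)      = _

Unit? : ∀ a b → Decidable (Unit a b)
Unit? a b u = map′
  (λ { refl → inj₂ refl , 1 , inj₂ refl , refl })
  (λ { (_ , v , _ , uv≡1) → m*n≡1⇒m≡1 u v uv≡1 })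
  (u ≟ 1)

NonUnit? : ∀ a b → Decidable (NonUnit a b)
NonUnit? a b n = M? a b n ×-dec ¬? (Unit? a b n)

Factors? : ∀ a b → Decidable (Factors a b)
Factors? a b n = map′
  (λ { (x , _ , y , _ , xy) → x , y , xy })
  (λ { (x , y , Nx@(Mx , _) , Ny@(My , _) , refl) →
         x , s≤s (m≤m*n x y {{M⇒nonZero My}}) ,
         y , s≤s (m≤n*m y x {{M⇒nonZero Mx}}) , Nx , Ny , refl })
  (anyUpTo? (λ x → anyUpTo?
    (λ y → NonUnit? a b x ×-dec NonUnit? a b y ×-dec n ≟ x * y) (suc n)) (suc n))

Atom? : ∀ a b → Decidable (Atom a b)
Atom? a b n = NonUnit? a b n ×-dec ¬? (Factors? a b n)

-- The cardinality of P ∩ {1, …, n}.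
count : {P : Pred ℕ 0ℓ} → Decidable P → ℕ → ℕ
count P? n = length (filter P? (applyUpTo suc n))

count-M-nonZero : ∀ a b n .{{_ : NonZero n}} → NonZero (count (M? a b) n)
count-M-nonZero a b (suc n) =
  >-nonZero (filter-some (M? a b) {applyUpTo suc (suc n)} (here (inj₂ refl)))

atomRatio : ∀ a b n .{{_ : NonZero n}} → ℚ
atomRatio a b n = ℚ._/_ (+ count (Atom? a b) n) (count (M? a b) n)
  {{count-M-nonZero a b n}}

-- Convergence of a sequence s₁, s₂, … of rationals to a rational limit;
-- rational ε suffice, as every positive real exceeds a positive rational.
_⟶_ : (∀ n → .{{_ : NonZero n}} → ℚ) → ℚ → Set
s ⟶ l = ∀ ε → 0ℚ ℚ.< ε →
  ∃[ N ] (∀ n .{{_ : NonZero n}} → N ≤ n → ℚ.∣ s n ℚ.- l ∣ ℚ.< ε)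

-- The limit defining the atomic density of M a b exists and equals l.
HasAtomicDensity : ℕ → ℕ → ℚ → Set
HasAtomicDensity a b l = (λ n → atomRatio a b n) ⟶ l

gcd-nonZero : ∀ {a} b → 1 ≤ a → NonZero (gcd a b)
gcd-nonZero {a} b 1≤a = ≢-nonZero (gcd[m,n]≢0 a b (inj₁ (m<n⇒n≢0 1≤a)))

{-# OPTIONS --safe #-}
module Submission where

-- Let q = gcd(a, b), a = q c and b = q m, so that c and m are coprime.  As b
-- divides a (a - 1), c is inverse to q modulo m, so apart from 1 the monoid
-- consists of the multiples of q that are 1 modulo m.  A product of two such
-- elements lies in the class of a * a modulo q b, which has density 1/q in
-- the monoid; outside this class everything but 1 is an atom.  An element of
-- this class has the form q * q * k, and it is a product of q e and q f as
-- soon as k = f e with e in the class of c modulo m; then f is in that class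
-- as well (splits⇒factors).  So the theorem follows once almost all k have a
-- divisor in the class of c (almostAll-divisor).  For q = 1 the divisor must
-- also be nontrivial, which is achieved by prescribing its class modulo a
-- larger modulus (almostAll-splits-1).
--
-- Dirichlet's theorem is not needed for this.  Let S be a set of residues that
-- contains 1 but not c, and call a prime p moving if p S is not contained in S.
-- A positive integer n in the class of c sends 1 to c, out of S, so it has a
-- moving prime factor.  Fix a class modulo a multiple P of m that is coprime to
-- P and refines the class of c.  Every n in this class is divisible by a moving
-- prime p not dividing P, and the n divisible by p form a single class modulo
-- p P.  Summing 1/n up to x, the whole class contributes about (log x)/P and
-- each p at most about 1/p + (log x)/(p P); hence finitely many moving primes
-- have reciprocal sum at least 1/2 (reciprocals≥½).  Including these primes in
-- P and repeating, the reciprocal sum of the moving primes diverges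
-- (reciprocals-diverge), so by the sieve almost all k have a moving prime
-- factor (allBut-prime-divisor).  If p moves x in S, then S can be enlarged by
-- p x, and a divisor of k, coprime to p, that sends p x to c becomes a divisor
-- that sends x to c when multiplied by p.  Induction on the complement of S
-- starts from S = {1} (almostAll-reach).
--
-- The counts are compared up to a bound x, with error terms that are small
-- against the size of the monoid, and these inequalities of integers give the
-- limit (ratio-close).

open import Defs
open import Data.Fin.Base using (Fin; toℕ)
open import Data.Fin.Properties using (any?; toℕ-fromℕ<; toℕ-injective; toℕ<n)
open import Data.Fin.Subset using (Subset; _∪_; ⁅_⁆; _⊃_) renaming (_∈_ to _∈ₛ_; _∉_ to _∉ₛ_)
open import Data.Fin.Subset.Induction using (Acc; acc; ⊃-wellFounded)
open import Data.Fin.Subset.Properties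
  using (_∈?_; x∈⁅x⁆; x∈⁅y⁆⇒x≡y; x∈p∪q⁻; p⊆p∪q; q⊆p∪q)
import Data.Integer.Properties as ℤ
import Data.Integer.Tactic.RingSolver as ℤSolver
open import Data.List.Base using (List; []; _∷_; map; _++_; filter; upTo; length; applyUpTo)
open import Data.List.Membership.Propositional using (_∈_)
open import Data.List.Membership.Propositional.Properties
  using (∈-filter⁺; ∈-filter⁻; ∈-upTo⁺; ∈-upTo⁻)
open import Data.List.Relation.Unary.All as All using (All; []; _∷_)
import Data.List.Relation.Unary.All.Properties as All
open import Data.List.Relation.Unary.AllPairs using ([]; _∷_)
open import Data.List.Relation.Unary.Any using (Any; here; there)
open import Data.List.Relation.Unary.Unique.Propositional using (Unique)
import Data.List.Relation.Unary.Unique.Propositional.Properties as Unique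
open import Data.Nat.Base hiding (_/_)
open import Data.Nat.Coprimality as Coprimality using (Coprime; coprime-divisor; coprime-/gcd)
open import Data.Nat.DivMod renaming (_/_ to infixl 7 _÷_)
open import Data.Nat.Divisibility
open import Data.Nat.GCD using (gcd; gcd[m,n]∣m; gcd[m,n]∣n)
open import Data.Nat.ListAction using (product; sum)
open import Data.Nat.ListAction.Properties using (∈⇒∣product; product-++)
open import Data.Nat.Primality using
  (Prime; prime?; euclidsLemma; prime⇒irreducible; ¬prime[1]; prime⇒nonZero; productOfPrimes≢0)
open import Data.Nat.Primality.Factorisation using (factorise)
open import Data.Nat.Properties
open import Data.Nat.Tactic.RingSolver using (solve-∀)
open import Data.Product.Base using (_×_; _,_; ∃-syntax; proj₁; proj₂)
open import Data.Rational.Base as ℚ using (mkℚ; 0ℚ; 1ℚ; toℚᵘ; _-_; _/_)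
import Data.Rational.Properties as ℚ
open import Data.Rational.Unnormalised.Base as ℚᵘ using (mkℚᵘ; 1ℚᵘ)
import Data.Rational.Unnormalised.Properties as ℚᵘ
open import Data.Sum.Base using (_⊎_; inj₁; inj₂)
open import Function.Base using (_∘_)
open import Level using (0ℓ)
open import Relation.Binary.PropositionalEquality
open import Relation.Nullary
open import Relation.Nullary.Decidable using (decidable-stable)
open import Relation.Unary using (Pred; Decidable)

-- Finite sums

-- The sum f 0 + … + f (n - 1).
∑ : ℕ → (ℕ → ℕ) → ℕ
∑ zero    f = 0
∑ (suc n) f = ∑ n f + f n

-- The indicator of a decidable proposition, valued in {0, 1}.
𝟙 : {A : Set} → Dec A → ℕ
𝟙 (yes _) = 1
𝟙 (no  _) = 0

𝟙-yes : {A : Set} (d : Dec A) → A → 𝟙 d ≡ 1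
𝟙-yes (yes _) _ = refl
𝟙-yes (no ¬a) a = contradiction a ¬a

𝟙-no : {A : Set} (d : Dec A) → ¬ A → 𝟙 d ≡ 0
𝟙-no (yes a) ¬a = contradiction a ¬a
𝟙-no (no  _) _  = refl

∑-mono : ∀ n {f g} → (∀ i → i < n → f i ≤ g i) → ∑ n f ≤ ∑ n g
∑-mono zero    f≤g = z≤n
∑-mono (suc n) f≤g =
  +-mono-≤ (∑-mono n (λ i i<n → f≤g i (m<n⇒m<1+n i<n))) (f≤g n ≤-refl)

∑-cong : ∀ n {f g} → (∀ i → i < n → f i ≡ g i) → ∑ n f ≡ ∑ n g
∑-cong zero    f≡g = refl
∑-cong (suc n) f≡g =
  cong₂ _+_ (∑-cong n (λ i i<n → f≡g i (m<n⇒m<1+n i<n))) (f≡g n ≤-refl)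

∑-distrib-+ : ∀ n f g → ∑ n (λ i → f i + g i) ≡ ∑ n f + ∑ n g
∑-distrib-+ zero    f g = refl
∑-distrib-+ (suc n) f g rewrite ∑-distrib-+ n f g =
  rearrange (∑ n f) (∑ n g) (f n) (g n)
  where
  rearrange : ∀ a b c d → (a + b) + (c + d) ≡ (a + c) + (b + d)
  rearrange = solve-∀

∑-*ˡ : ∀ n c f → ∑ n (λ i → c * f i) ≡ c * ∑ n f
∑-*ˡ zero    c f = sym (*-zeroʳ c)
∑-*ˡ (suc n) c f rewrite ∑-*ˡ n c f = sym (*-distribˡ-+ c (∑ n f) (f n))

∑-zero : ∀ n {f} → (∀ i → i < n → f i ≡ 0) → ∑ n f ≡ 0
∑-zero zero    f≡0 = refl
∑-zero (suc n) f≡0 =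
  cong₂ _+_ (∑-zero n (λ i i<n → f≡0 i (m<n⇒m<1+n i<n))) (f≡0 n ≤-refl)

∑-const : ∀ n c → ∑ n (λ _ → c) ≡ n * c
∑-const zero    c = refl
∑-const (suc n) c rewrite ∑-const n c = +-comm (n * c) c

∑-++ : ∀ m n f → ∑ (m + n) f ≡ ∑ m f + ∑ n (λ i → f (m + i))
∑-++ m zero    f rewrite +-identityʳ m = sym (+-identityʳ (∑ m f))
∑-++ m (suc n) f rewrite +-suc m n | ∑-++ m n f =
  +-assoc (∑ m f) (∑ n (λ i → f (m + i))) (f (m + n))

∑-monoˡ-≤ : ∀ f {m n} → m ≤ n → ∑ m f ≤ ∑ n f
∑-monoˡ-≤ f {m} m≤n with m≤n⇒∃[o]m+o≡n m≤n
... | k , refl rewrite ∑-++ m k f = m≤m+n _ _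

-- Splitting a sum into consecutive blocks of length K.
∑-blocks : ∀ K t f → ∑ (t * K) f ≡ ∑ t (λ b → ∑ K (λ i → f (b * K + i)))
∑-blocks K zero    f = refl
∑-blocks K (suc t) f rewrite +-comm K (t * K) | ∑-++ (t * K) K f | ∑-blocks K t f = refl

-- If at most one term of a sum is nonzero, then a bound on the terms bounds
-- the sum.
∑-atMostOne : ∀ n V {f} → (∀ i → i < n → f i ≤ V) →
  (∀ {i j} → i < j → j < n → f i ≡ 0 ⊎ f j ≡ 0) → ∑ n f ≤ V
∑-atMostOne zero    V f≤V one = z≤n
∑-atMostOne (suc n) V {f} f≤V one with f n ≟ 0
... | yes fn≡0 rewrite fn≡0 | +-identityʳ (∑ n f) =
  ∑-atMostOne n V (λ i i<n → f≤V i (m<n⇒m<1+n i<n))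
    (λ i<j j<n → one i<j (m<n⇒m<1+n j<n))
... | no fn≢0 =
  subst (λ z → z + f n ≤ V) (sym (∑-zero n earlier≡0)) (f≤V n ≤-refl)
  where
  earlier≡0 : ∀ i → i < n → f i ≡ 0
  earlier≡0 i i<n with one i<n ≤-refl
  ... | inj₁ fi≡0 = fi≡0
  ... | inj₂ fn≡0 = contradiction fn≡0 fn≢0

-- The multiples of p in {1, …, y p} are p j for j in {1, …, y}.
∑-multiples : ∀ p .{{_ : NonZero p}} y (g : ℕ → ℕ) →
  ∑ (y * p) (λ i → 𝟙 (p ∣? suc i) * g (suc i)) ≡ ∑ y (λ j → g (p * suc j))
∑-multiples p@(suc p-1) y g = trans (∑-blocks p y _) (∑-cong y λ b _ → block b)
  where
  shift : ∀ b i → suc (b * p + i) ≡ b * p + suc i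
  shift b i = sym (+-suc (b * p) i)
  last≡ : ∀ b → suc (b * p + p-1) ≡ p * suc b
  last≡ b = trans (shift b p-1) (trans (+-comm (b * p) p) (*-comm (suc b) p))
  ∤ : ∀ b i → i < p-1 → p ∤ suc (b * p + i)
  ∤ b i i<p-1 p∣ = >⇒∤ (s<s i<p-1)
    (∣m+n∣m⇒∣n (subst (p ∣_) (shift b i) p∣) (n∣m*n b))
  block : ∀ b → ∑ p (λ i → 𝟙 (p ∣? suc (b * p + i)) * g (suc (b * p + i))) ≡ g (p * suc b)
  block b = cong₂ _+_
    (∑-zero p-1 λ i i<p-1 → cong (_* g (suc (b * p + i))) (𝟙-no (p ∣? _) (∤ b i i<p-1)))
    (trans (cong (_* g (suc (b * p + p-1)))
             (𝟙-yes (p ∣? _) (subst (p ∣_) (sym (last≡ b)) (m∣m*n (suc b)))))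
      (trans (+-identityʳ _) (cong g (last≡ b))))

-- The interval s + 1, s + 2, …, s + x with s < d contains as many multiples of
-- d as the quotient of s + x by d, with remainder r.
∑-hits : ∀ d .{{_ : NonZero d}} s x → s < d →
  ∃[ r ] (r < d × s + x ≡ r + d * ∑ x (λ i → 𝟙 (d ∣? (s + suc i))))
∑-hits d s zero s<d = s , s<d , (begin
  s + 0      ≡⟨ cong (s +_) (*-zeroʳ d) ⟨
  s + d * 0  ∎)
  where open ≡-Reasoning
∑-hits d s (suc x) s<d with ∑-hits d s x s<d
... | r , r<d , eq with d ∣? (s + suc x)
...   | yes d∣ = 0 , >-nonZero⁻¹ d , (begin
  s + suc x      ≡⟨ +-suc s x ⟩
  suc (s + x)    ≡⟨ cong suc eq ⟩
  suc r + d * c  ≡⟨ cong (_+ d * c) 1+r≡d ⟩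
  d + d * c      ≡⟨ *-suc d c ⟨
  d * suc c      ≡⟨ cong (d *_) (+-comm 1 c) ⟩
  d * (c + 1)    ∎)
  where
  open ≡-Reasoning
  c = ∑ x (λ i → 𝟙 (d ∣? (s + suc i)))
  d∣1+r : d ∣ suc r
  d∣1+r = ∣m+n∣m⇒∣n (subst (d ∣_) (trans (+-suc s x)
    (trans (cong suc eq) (+-comm (suc r) (d * c)))) d∣) (m∣m*n c)
  1+r≡d : suc r ≡ d
  1+r≡d = ≤-antisym r<d (∣⇒≤ d∣1+r)
...   | no d∤ = suc r , ≤∧≢⇒< r<d 1+r≢d , (begin
  s + suc x            ≡⟨ +-suc s x ⟩
  suc (s + x)          ≡⟨ cong suc eq ⟩
  suc r + d * c        ≡⟨ cong (λ z → suc r + d * z) (+-identityʳ c) ⟨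
  suc r + d * (c + 0)  ∎)
  where
  open ≡-Reasoning
  c = ∑ x (λ i → 𝟙 (d ∣? (s + suc i)))
  1+r≢d : suc r ≢ d
  1+r≢d refl = d∤ (subst (d ∣_) (sym (trans (+-suc s x)
    (trans (cong suc eq) (sym (*-suc d c))))) (m∣m*n (suc c)))

-- Sets of integers of density one

-- Outside a set of upper density at most 1 / t, every positive integer
-- satisfies G.  The exceptional set is given by a weight E that is nonzero on
-- it, so that unions of exceptional sets are sums of weights and G need not be
-- decidable.  For t = 0 there is no condition on the size.
AllBut1/ : ℕ → Pred ℕ 0ℓ → Set
AllBut1/ t G = ∃[ E ] ((∀ k → 1 ≤ k → E k ≡ 0 → G k) ×
  ∃[ N ] (∀ n → N ≤ n → t * ∑ n (E ∘ suc) ≤ n))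

-- G holds outside sets of arbitrarily small upper density.
AlmostAll : Pred ℕ 0ℓ → Set
AlmostAll G = ∀ t → AllBut1/ t G

module _ {G H : Pred ℕ 0ℓ} where

  allBut-map : ∀ t → (∀ k → 1 ≤ k → G k → H k) → AllBut1/ t G → AllBut1/ t H
  allBut-map t G⇒H (E , E≡0⇒G , bound) = E , (λ k 1≤k → G⇒H k 1≤k ∘ E≡0⇒G k 1≤k) , bound

  allBut-∩ : ∀ t → AllBut1/ (2 * t) G → AllBut1/ (2 * t) H →
    AllBut1/ t (λ k → G k × H k)
  allBut-∩ t (E , E≡0⇒G , N , boundE) (F , F≡0⇒H , N′ , boundF) =
    (λ k → E k + F k) ,
    (λ k 1≤k eq → E≡0⇒G k 1≤k (m+n≡0⇒m≡0 (E k) eq) , F≡0⇒H k 1≤k (m+n≡0⇒n≡0 (E k) eq)) ,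
    N + N′ , λ n N+N′≤n → *-cancelˡ-≤ 2 (begin
      2 * (t * ∑ n (λ i → E (suc i) + F (suc i)))       ≡⟨ cong (λ z → 2 * (t * z)) (∑-distrib-+ n _ _) ⟩
      2 * (t * (∑ n (E ∘ suc) + ∑ n (F ∘ suc)))         ≡⟨ distribute t (∑ n (E ∘ suc)) (∑ n (F ∘ suc)) ⟩
      2 * t * ∑ n (E ∘ suc) + 2 * t * ∑ n (F ∘ suc)
        ≤⟨ +-mono-≤ (boundE n (m+n≤o⇒m≤o N N+N′≤n)) (boundF n (m+n≤o⇒n≤o N N+N′≤n)) ⟩
      n + n                                             ≡⟨ cong (n +_) (+-identityʳ n) ⟨
      2 * n                                             ∎)
    where
    open ≤-Reasoning
    distribute : ∀ t a b → 2 * (t * (a + b)) ≡ 2 * t * a + 2 * t * b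
    distribute = solve-∀

always : {G : Pred ℕ 0ℓ} → (∀ k → 1 ≤ k → G k) → AlmostAll G
always all-G t = (λ _ → 0) , (λ k 1≤k _ → all-G k 1≤k) , 0 , λ n _ →
  subst (λ z → t * z ≤ n) (sym (∑-zero n (λ _ _ → refl)))
    (subst (_≤ n) (sym (*-zeroʳ t)) z≤n)

almostAll-map : {G H : Pred ℕ 0ℓ} → (∀ k → 1 ≤ k → G k → H k) → AlmostAll G → AlmostAll H
almostAll-map G⇒H aa t = allBut-map t G⇒H (aa t)

almostAll-List : {G : ℕ → Pred ℕ 0ℓ} {L : List ℕ} → All (AlmostAll ∘ G) L →
  AlmostAll (λ k → All (λ p → G p k) L)
almostAll-List []         = always λ _ _ → []
almostAll-List (aa ∷ aas) t = allBut-map t (λ _ _ (g , gs) → g ∷ gs)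
  (allBut-∩ t (aa (2 * t)) (almostAll-List aas (2 * t)))

-- If G holds for almost all k, then almost all n have the property that
-- n / d satisfies G whenever d divides n.  An exceptional set for n consists of
-- the multiples by d of one for k, which is no larger up to any bound.
almostAll-quotient : {G : Pred ℕ 0ℓ} → ∀ d .{{_ : NonZero d}} → AlmostAll G →
  AlmostAll (λ n → ∀ k → n ≡ d * k → G k)
almostAll-quotient {G} d aa t with aa t
... | E , E≡0⇒G , N , bound = E′ , E′≡0⇒G , N , λ n N≤n → begin
  t * ∑ n (E′ ∘ suc)                        ≤⟨ *-monoʳ-≤ t (∑-monoˡ-≤ _ (m≤m*n n d)) ⟩
  t * ∑ (n * d) (E′ ∘ suc)                  ≡⟨ cong (t *_) (∑-multiples d n (λ k → E (k ÷ d))) ⟩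
  t * ∑ n (λ j → E (d * suc j ÷ d))         ≡⟨ cong (t *_) (∑-cong n λ j _ → cong E (cancel (suc j))) ⟩
  t * ∑ n (E ∘ suc)                         ≤⟨ bound n N≤n ⟩
  n                                         ∎
  where
  open ≤-Reasoning
  cancel : ∀ k → d * k ÷ d ≡ k
  cancel k = trans (cong (_÷ d) (*-comm d k)) (m*n/n≡m k d)
  E′ : ℕ → ℕ
  E′ n = 𝟙 (d ∣? n) * E (n ÷ d)
  E′≡0⇒G : ∀ n → 1 ≤ n → E′ n ≡ 0 → ∀ k → n ≡ d * k → G k
  E′≡0⇒G n 1≤n eq k refl = E≡0⇒G k
    (>-nonZero⁻¹ k {{m*n≢0⇒n≢0 d {{>-nonZero 1≤n}}}})
    (begin-equality
      E k                             ≡⟨ cong E (cancel k) ⟨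
      E (d * k ÷ d)                   ≡⟨ +-identityʳ _ ⟨
      1 * E (d * k ÷ d)               ≡⟨ cong (_* E (d * k ÷ d)) (𝟙-yes (d ∣? (d * k)) (m∣m*n k)) ⟨
      𝟙 (d ∣? (d * k)) * E (d * k ÷ d) ≡⟨ eq ⟩
      0                               ∎)

-- Integers with no divisor in a given list of primes

-- The indicator of the integers that no element of L divides.
sieve : List ℕ → ℕ → ℕ
sieve []      k = 1
sieve (p ∷ L) k with p ∣? k
... | yes _ = 0
... | no  _ = sieve L k

sieve-∷ : ∀ p L k → sieve (p ∷ L) k + 𝟙 (p ∣? k) * sieve L k ≡ sieve L k
sieve-∷ p L k with p ∣? k
... | yes _ = +-identityʳ _
... | no  _ = +-identityʳ _

sieve≡0⇒∣ : ∀ L k → sieve L k ≡ 0 → Any (_∣ k) L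
sieve≡0⇒∣ (p ∷ L) k eq with p ∣? k
... | yes p∣k = here p∣k
... | no  _   = there (sieve≡0⇒∣ L k eq)

prime∣prime⇒≡ : ∀ {p l} → Prime p → Prime l → l ∣ p → l ≡ p
prime∣prime⇒≡ {p} pp pl l∣p with prime⇒irreducible pp l∣p
... | inj₁ refl = contradiction pl ¬prime[1]
... | inj₂ l≡p  = l≡p

sieve-prime-* : ∀ {p} {L} → Prime p → All Prime L → All (p ≢_) L →
  ∀ k → sieve L (p * k) ≡ sieve L k
sieve-prime-* pp [] [] k = refl
sieve-prime-* {p} {l ∷ L} pp (pl ∷ primes) (p≢l ∷ p≢) k with l ∣? (p * k) | l ∣? k
... | yes _  | yes _  = refl
... | no _   | no _   = sieve-prime-* pp primes p≢ k
... | no l∤  | yes l∣ = contradiction (∣n⇒∣m*n p l∣) l∤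
... | yes l∣ | no l∤  with euclidsLemma p k pl l∣
...   | inj₁ l∣p = contradiction (sym (prime∣prime⇒≡ pp pl l∣p)) p≢l
...   | inj₂ l∣k = contradiction l∣k l∤

-- The product of p - 1 over p in L.
φ : List ℕ → ℕ
φ L = product (map pred L)

-- The product of L times the sum of the reciprocals of the elements of L.
reciprocals : List ℕ → ℕ
reciprocals []      = 0
reciprocals (p ∷ L) = product L + p * reciprocals L

reciprocals-++ : ∀ L L′ →
  reciprocals (L ++ L′) ≡ reciprocals L * product L′ + product L * reciprocals L′
reciprocals-++ []      L′ = sym (+-identityʳ _)
reciprocals-++ (p ∷ L) L′ rewrite product-++ L L′ | reciprocals-++ L L′ =
  rearrange (product L) (product L′) (reciprocals L) (reciprocals L′) p
  where
  rearrange : ∀ x y e f p → x * y + p * (e * y + x * f) ≡ (x + p * e) * y + p * x * f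
  rearrange = solve-∀

-- In each period, exactly φ L integers pass the sieve by distinct primes L.  For a
-- further prime p, the multiples of p that pass the sieve by L are p times the
-- integers that do.
∑-sieve : ∀ {L} → All Prime L → Unique L → ∀ x →
  ∑ (x * product L) (sieve L ∘ suc) ≡ x * φ L
∑-sieve [] [] x = begin
  ∑ (x * 1) (λ _ → 1)  ≡⟨ ∑-const (x * 1) 1 ⟩
  x * 1 * 1            ≡⟨ *-identityʳ (x * 1) ⟩
  x * 1                ∎
  where open ≡-Reasoning
∑-sieve {p ∷ L} (pp ∷ primes) (p≢ ∷ unique) x =
  +-cancelʳ-≡ (x * φ L) _ _ (begin
  ∑ n (sieve (p ∷ L) ∘ suc) + x * φ L
    ≡⟨ cong (∑ n (sieve (p ∷ L) ∘ suc) +_) (sym multiples) ⟩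
  ∑ n (sieve (p ∷ L) ∘ suc) + ∑ n (λ i → 𝟙 (p ∣? suc i) * sieve L (suc i))
    ≡⟨ ∑-distrib-+ n _ _ ⟨
  ∑ n (λ i → sieve (p ∷ L) (suc i) + 𝟙 (p ∣? suc i) * sieve L (suc i))
    ≡⟨ ∑-cong n (λ i _ → sieve-∷ p L (suc i)) ⟩
  ∑ n (sieve L ∘ suc)            ≡⟨ cong (λ z → ∑ z (sieve L ∘ suc)) (sym (*-assoc x p (product L))) ⟩
  ∑ (x * p * product L) (sieve L ∘ suc) ≡⟨ ∑-sieve primes unique (x * p) ⟩
  x * p * φ L                    ≡⟨ cong (λ z → x * z * φ L) (suc-pred p) ⟨
  x * suc (pred p) * φ L         ≡⟨ rearrange x (pred p) (φ L) ⟩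
  x * (pred p * φ L) + x * φ L   ∎)
  where
  open ≡-Reasoning
  instance
    p≢0 : NonZero p
    p≢0 = prime⇒nonZero pp
  n = x * (p * product L)
  rearrange : ∀ x q f → x * suc q * f ≡ x * (q * f) + x * f
  rearrange = solve-∀
  swap : ∀ x p y → x * (p * y) ≡ (x * y) * p
  swap = solve-∀
  multiples : ∑ n (λ i → 𝟙 (p ∣? suc i) * sieve L (suc i)) ≡ x * φ L
  multiples = begin
    ∑ n (λ i → 𝟙 (p ∣? suc i) * sieve L (suc i))
      ≡⟨ cong (λ z → ∑ z (λ i → 𝟙 (p ∣? suc i) * sieve L (suc i))) (swap x p (product L)) ⟩
    ∑ (x * product L * p) (λ i → 𝟙 (p ∣? suc i) * sieve L (suc i))
      ≡⟨ ∑-multiples p (x * product L) (sieve L) ⟩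
    ∑ (x * product L) (λ j → sieve L (p * suc j))
      ≡⟨ ∑-cong (x * product L) (λ j _ → sieve-prime-* pp primes p≢ (suc j)) ⟩
    ∑ (x * product L) (sieve L ∘ suc) ≡⟨ ∑-sieve primes unique x ⟩
    x * φ L ∎

-- Divided by the squared product of L, this is
-- ∏ (1 - 1/p) * (1 + ∑ 1/p) ≤ 1.
φ-reciprocals : ∀ L → φ L * (product L + reciprocals L) ≤ product L * product L
φ-reciprocals []          = ≤-refl
φ-reciprocals (zero ∷ L)  = ≤-refl
φ-reciprocals (suc p ∷ L) = begin
  p * f * (suc p * x + (x + suc p * e))         ≤⟨ m≤m+n _ (f * x + f * suc p * e) ⟩
  p * f * (suc p * x + (x + suc p * e)) + (f * x + f * suc p * e) ≡⟨ rearrange p f x e ⟩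
  suc p * suc p * (f * (x + e))                 ≤⟨ *-monoʳ-≤ (suc p * suc p) (φ-reciprocals L) ⟩
  suc p * suc p * (x * x)                       ≡⟨ square p x ⟩
  suc p * x * (suc p * x)                       ∎
  where
  open ≤-Reasoning
  f = φ L
  x = product L
  e = reciprocals L
  rearrange : ∀ p f x e → p * f * (suc p * x + (x + suc p * e)) + (f * x + f * suc p * e) ≡
    suc p * suc p * (f * (x + e))
  rearrange = solve-∀
  square : ∀ p x → suc p * suc p * (x * x) ≡ suc p * x * (suc p * x)
  square = solve-∀

-- If the reciprocals of distinct primes L sum to at least 2 t, then all but a
-- proportion 1 / t of the integers have a divisor in L.
allBut-prime-divisor : ∀ {L} → All Prime L → Unique L → ∀ t →
  2 * t * product L ≤ reciprocals L → AllBut1/ t (λ k → Any (_∣ k) L)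
allBut-prime-divisor {L} primes unique t large =
  sieve L , (λ k _ → sieve≡0⇒∣ L k) , Q , λ n Q≤n → *-cancelˡ-≤ 2 (bound n Q≤n)
  where
  open ≤-Reasoning
  Q = product L
  instance
    Q≢0 : NonZero Q
    Q≢0 = productOfPrimes≢0 primes
  swap : ∀ t f q → 2 * t * f * q ≡ f * (2 * t * q)
  swap = solve-∀
  2tφ≤Q : 2 * t * φ L ≤ Q
  2tφ≤Q = *-cancelʳ-≤ (2 * t * φ L) Q Q (begin
    2 * t * φ L * Q             ≡⟨ swap t (φ L) Q ⟩
    φ L * (2 * t * Q)           ≤⟨ *-monoʳ-≤ (φ L) large ⟩
    φ L * reciprocals L         ≤⟨ *-monoʳ-≤ (φ L) (m≤n+m _ Q) ⟩
    φ L * (Q + reciprocals L)   ≤⟨ φ-reciprocals L ⟩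
    Q * Q                       ∎)
  assoc : ∀ t y f → 2 * (t * (y * f)) ≡ y * (2 * t * f)
  assoc = solve-∀
  double : ∀ n → n + n ≡ 2 * n
  double = solve-∀
  bound : ∀ n → Q ≤ n → 2 * (t * ∑ n (sieve L ∘ suc)) ≤ 2 * n
  bound n Q≤n = begin
    2 * (t * ∑ n (sieve L ∘ suc))
      ≤⟨ *-monoʳ-≤ 2 (*-monoʳ-≤ t (∑-monoˡ-≤ _ n≤)) ⟩
    2 * (t * ∑ (suc y * Q) (sieve L ∘ suc))
      ≡⟨ cong (λ z → 2 * (t * z)) (∑-sieve primes unique (suc y)) ⟩
    2 * (t * (suc y * φ L))   ≡⟨ assoc t (suc y) (φ L) ⟩
    suc y * (2 * t * φ L)     ≤⟨ *-monoʳ-≤ (suc y) 2tφ≤Q ⟩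
    Q + y * Q                 ≤⟨ +-mono-≤ Q≤n yQ≤n ⟩
    n + n                     ≡⟨ double n ⟩
    2 * n                     ∎
    where
    y = n ÷ Q
    yQ≤n : y * Q ≤ n
    yQ≤n = subst (y * Q ≤_) (sym (m≡m%n+[m/n]*n n Q)) (m≤n+m (y * Q) (n % Q))
    n≤ : n ≤ suc y * Q
    n≤ = subst (_≤ suc y * Q) (sym (m≡m%n+[m/n]*n n Q)) (+-monoˡ-≤ (y * Q) (<⇒≤ (m%n<n n Q)))

-- Divergence of reciprocal sums of primes

∈⇒≤sum : ∀ (f : ℕ → ℕ) {x L} → x ∈ L → f x ≤ sum (map f L)
∈⇒≤sum f {L = _ ∷ L} (here refl) = m≤m+n _ _
∈⇒≤sum f {L = _ ∷ L} (there x∈L) = ≤-trans (∈⇒≤sum f x∈L) (m≤n+m _ _)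

sum-mono : ∀ {f g : ℕ → ℕ} {L} → All (λ x → f x ≤ g x) L → sum (map f L) ≤ sum (map g L)
sum-mono []            = z≤n
sum-mono (fx≤gx ∷ f≤g) = +-mono-≤ fx≤gx (sum-mono f≤g)

sum-*ʳ : ∀ (f : ℕ → ℕ) c L → sum (map (λ x → f x * c) L) ≡ sum (map f L) * c
sum-*ʳ f c []      = refl
sum-*ʳ f c (x ∷ L) rewrite sum-*ʳ f c L = sym (*-distribʳ-+ c (f x) (sum (map f L)))

∑-sum-swap : ∀ n (f : ℕ → ℕ → ℕ) L →
  ∑ n (λ i → sum (map (f i) L)) ≡ sum (map (λ x → ∑ n (λ i → f i x)) L)
∑-sum-swap n f []      = ∑-zero n (λ _ _ → refl)
∑-sum-swap n f (x ∷ L) = trans (∑-distrib-+ n _ _) (cong (_ +_) (∑-sum-swap n f L))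

-- The reciprocal of n in units of 1 / F, rounded down.  It is exact when n
-- divides F; the value at 0 plays no role.
unit : ℕ → ℕ → ℕ
unit F zero    = 0
unit F (suc n) = F ÷ suc n

unit≤ : ∀ F n → unit F n ≤ F
unit≤ F zero    = z≤n
unit≤ F (suc n) = m/n≤m F (suc n)

unit-exact : ∀ F {n} → 1 ≤ n → n ∣ F → n * unit F n ≡ F
unit-exact F {suc n} _ n∣F = m*[n/m]≡n n∣F

unit-anti : ∀ F {m n} → 1 ≤ m → m ≤ n → unit F n ≤ unit F m
unit-anti F {suc m} {suc n} _ m≤n = /-monoʳ-≤ F m≤n

unit-* : ∀ F {p n} → 1 ≤ p → 1 ≤ n → p ∣ F → F * unit F (p * n) ≤ unit F p * unit F n
unit-* F p@{suc _} n@{suc _} 1≤p _ p∣F = begin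
  F * (F ÷ (p * n))              ≡⟨ cong₂ _*_ (sym (unit-exact F 1≤p p∣F)) F/pn≡ ⟩
  p * unit F p * (F ÷ n ÷ p)     ≡⟨ rearrange p (unit F p) (F ÷ n ÷ p) ⟩
  unit F p * (F ÷ n ÷ p * p)     ≤⟨ *-monoʳ-≤ (unit F p) (m/n*n≤m (F ÷ n) p) ⟩
  unit F p * (F ÷ n)             ∎
  where
  open ≤-Reasoning
  rearrange : ∀ p u y → p * u * y ≡ u * (y * p)
  rearrange = solve-∀
  F/pn≡ : F ÷ (p * n) ≡ F ÷ n ÷ p
  F/pn≡ = trans (/-congʳ {m = F} (*-comm p n)) (sym (m/n/o≡m/[n*o] F n p))

∣! : ∀ {m n} → 1 ≤ m → m ≤ n → m ∣ n !
∣! {suc m} _ m≤n = ∣-trans (m∣m*n (m !)) (m≤n⇒m!∣n! m≤n)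

-- The harmonic series diverges: its partial sum to 2 ^ k is at least k / 2.
harmonic : ∀ F (h : ℕ → ℕ) k → (∀ j → 1 ≤ j → j ≤ 2 ^ k → F ≤ h j * j) →
  (∀ {i j} → 1 ≤ i → i ≤ j → h j ≤ h i) → k * F ≤ 2 * ∑ (2 ^ k) (h ∘ suc)
harmonic F h zero    F≤hj*j anti = z≤n
harmonic F h (suc k) F≤hj*j anti = begin
  F + k * F             ≤⟨ +-mono-≤ half (harmonic F h k
                            (λ j 1≤j j≤K → F≤hj*j j 1≤j (≤-trans j≤K (m≤m+n K _))) anti) ⟩
  2 * ∑ K (λ i → h (suc (K + i))) + 2 * ∑ K (h ∘ suc)   ≡⟨ +-comm _ (2 * ∑ K (h ∘ suc)) ⟩
  2 * ∑ K (h ∘ suc) + 2 * ∑ K (λ i → h (suc (K + i)))   ≡⟨ *-distribˡ-+ 2 (∑ K (h ∘ suc)) _ ⟨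
  2 * (∑ K (h ∘ suc) + ∑ K (λ i → h (suc (K + i))))     ≡⟨ cong (2 *_) (∑-++ K K (h ∘ suc)) ⟨
  2 * ∑ (K + K) (h ∘ suc)   ≡⟨ cong (λ z → 2 * ∑ (K + z) (h ∘ suc)) (+-identityʳ K) ⟨
  2 * ∑ (2 * K) (h ∘ suc)   ∎
  where
  open ≤-Reasoning
  K = 2 ^ k
  swap : ∀ x K → x * (2 * K) ≡ 2 * (K * x)
  swap = solve-∀
  half : F ≤ 2 * ∑ K (λ i → h (suc (K + i)))
  half = begin
    F                         ≤⟨ F≤hj*j (2 * K) (m^n>0 2 (suc k)) ≤-refl ⟩
    h (2 * K) * (2 * K)       ≡⟨ swap (h (2 * K)) K ⟩
    2 * (K * h (2 * K))       ≡⟨ cong (2 *_) (∑-const K (h (2 * K))) ⟨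
    2 * ∑ K (λ _ → h (2 * K)) ≤⟨ *-monoʳ-≤ 2 (∑-mono K λ i i<K → anti (s≤s z≤n)
      (subst (suc (K + i) ≤_) (cong (K +_) (sym (+-identityʳ K))) (+-monoʳ-< K i<K))) ⟩
    2 * ∑ K (λ i → h (suc (K + i))) ∎

reciprocals-unit : ∀ F {L} → All (λ p → 1 ≤ p × p ∣ F) L →
  F * reciprocals L ≡ product L * sum (map (unit F) L)
reciprocals-unit F []                         = *-zeroʳ F
reciprocals-unit F {p ∷ L} ((1≤p , p∣F) ∷ ps) = begin
  F * (Q + p * e)            ≡⟨ expand F Q p e ⟩
  F * Q + p * (F * e)        ≡⟨ cong₂ (λ x y → x * Q + p * y)
                                    (sym (unit-exact F 1≤p p∣F)) (reciprocals-unit F ps) ⟩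
  p * u * Q + p * (Q * s)    ≡⟨ collect p u Q s ⟩
  p * Q * (u + s)            ∎
  where
  open ≡-Reasoning
  Q = product L
  e = reciprocals L
  u = unit F p
  s = sum (map (unit F) L)
  expand : ∀ F Q p e → F * (Q + p * e) ≡ F * Q + p * (F * e)
  expand = solve-∀
  collect : ∀ p u Q s → p * u * Q + p * (Q * s) ≡ p * Q * (u + s)
  collect = solve-∀

-- Suppose that every positive n in the class of r modulo P has a prime factor
-- in B that does not divide P.  Then finitely many such primes have reciprocal
-- sum at least 1/2.  Indeed, the reciprocals of the n in the progression sum to
-- about log x / P up to x, while those of the n that are divisible by p sum to
-- at most about 1/p + log x / (p P).
module _ (P r : ℕ) .{{_ : NonZero P}} {B : Pred ℕ 0ℓ} (B? : Decidable B)
  (factor : ∀ n → 1 ≤ n → n % P ≡ r % P → ∃[ p ] (Prime p × p ∣ n × p ∤ P × B p)) where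

  private
    -- The harmonic sum up to N is at least 3 P.  All integers whose reciprocals
    -- occur exactly are at most X, so that their factorial F is a common
    -- denominator.
    ρ k N X F : ℕ
    ρ = r % P
    k = 6 * P
    N = 2 ^ k
    X = suc N * P
    F = X !

    -- The terms of the progression that enter the sums.
    n : ℕ → ℕ
    n i = ρ + suc i * P

    u : ℕ → ℕ
    u = unit F

    -- The reciprocal sum of the first N multiples of P.
    A : ℕ
    A = ∑ N (λ j → u (suc j * P))

    Q? : Decidable (λ p → Prime p × p ∤ P × B p)
    Q? p = prime? p ×-dec ¬? (p ∣? P) ×-dec B? p

    L : List ℕ
    L = filter Q? (upTo (suc X))

    S : ℕ
    S = sum (map u L)

    instance
      F≢0 : NonZero F
      F≢0 = X !≢0

    1≤n : ∀ i → 1 ≤ n i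
    1≤n i = ≤-trans (>-nonZero⁻¹ P) (≤-trans (m≤m+n P (i * P)) (m≤n+m (suc i * P) ρ))

    n≤X : ∀ {i} → i < N → n i ≤ X
    n≤X {i} i<N = +-mono-≤ (<⇒≤ (m%n<n r P)) (*-monoˡ-≤ P i<N)

    L-factors : All (λ p → 1 ≤ p × p ∣ F) L
    L-factors = All.tabulate λ {p} p∈L →
      let p<1+X , pp , _ = ∈-filter⁻ Q? {xs = upTo (suc X)} p∈L
          1≤p = >-nonZero⁻¹ p {{prime⇒nonZero pp}}
      in 1≤p , ∣! 1≤p (s≤s⁻¹ (∈-upTo⁻ p<1+X))

    A-large : 3 * F ≤ A
    A-large = *-cancelˡ-≤ (2 * P) {{m*n≢0 2 P}} (begin
      2 * P * (3 * F)   ≡⟨ rearrange P F ⟩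
      6 * P * F         ≤⟨ harmonic F (λ j → P * u (j * P)) k exact anti ⟩
      2 * ∑ N (λ j → P * u (suc j * P)) ≡⟨ cong (2 *_) (∑-*ˡ N P _) ⟩
      2 * (P * A)       ≡⟨ *-assoc 2 P A ⟨
      2 * P * A         ∎)
      where
      open ≤-Reasoning
      rearrange : ∀ P F → 2 * P * (3 * F) ≡ 6 * P * F
      rearrange = solve-∀
      swap : ∀ P u j → j * P * u ≡ P * u * j
      swap = solve-∀
      1≤jP : ∀ {j} → 1 ≤ j → 1 ≤ j * P
      1≤jP 1≤j = *-mono-≤ 1≤j (>-nonZero⁻¹ P)
      exact : ∀ j → 1 ≤ j → j ≤ N → F ≤ P * u (j * P) * j
      exact j 1≤j j≤N = ≤-reflexive (trans
        (sym (unit-exact F (1≤jP 1≤j) (∣! (1≤jP 1≤j) (≤-trans (*-monoˡ-≤ P j≤N) (m≤n+m (N * P) P)))))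
        (swap P (u (j * P)) j))
      anti : ∀ {i j} → 1 ≤ i → i ≤ j → P * u (j * P) ≤ P * u (i * P)
      anti 1≤i i≤j = *-monoʳ-≤ P (unit-anti F (1≤jP 1≤i) (*-monoˡ-≤ P i≤j))

    -- Shifted by one place, n i is at most (i + 2) P.
    lower : A ≤ F + ∑ N (u ∘ n)
    lower = begin
      A                                              ≤⟨ ∑-monoˡ-≤ _ (n≤1+n N) ⟩
      ∑ (1 + N) (λ j → u (suc j * P))                ≡⟨ ∑-++ 1 N _ ⟩
      u (1 * P) + ∑ N (λ j → u (suc (suc j) * P))    ≤⟨ +-mono-≤ (unit≤ F (1 * P))
        (∑-mono N λ i _ → unit-anti F (1≤n i) (+-monoˡ-≤ (suc i * P) (<⇒≤ (m%n<n r P)))) ⟩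
      F + ∑ N (u ∘ n)                                ∎
      where open ≤-Reasoning

    covered : ∀ i → i < N → F * u (n i) ≤ sum (map (λ p → 𝟙 (p ∣? n i) * (F * u (n i))) L)
    covered i i<N with factor (n i) (1≤n i) (trans ([m+kn]%n≡m%n ρ (suc i) P) (m%n%n≡m%n r P))
    ... | p , pp , p∣n , p∤P , Bp = begin
      F * u (n i)                      ≡⟨ +-identityʳ _ ⟨
      1 * (F * u (n i))                ≡⟨ cong (_* (F * u (n i))) (𝟙-yes (p ∣? n i) p∣n) ⟨
      𝟙 (p ∣? n i) * (F * u (n i))     ≤⟨ ∈⇒≤sum (λ p → 𝟙 (p ∣? n i) * (F * u (n i))) p∈L ⟩
      sum (map (λ p → 𝟙 (p ∣? n i) * (F * u (n i))) L) ∎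
      where
      open ≤-Reasoning
      p∈L : p ∈ L
      p∈L = ∈-filter⁺ Q? (∈-upTo⁺ (s≤s (≤-trans (∣⇒≤ {{>-nonZero (1≤n i)}} p∣n) (n≤X i<N))))
        (pp , p∤P , Bp)

    -- Among p consecutive terms of the progression only one is divisible by p.
    -- In the first p terms it is at least p, and from term b p onwards it is at
    -- least b p P.
    upper : ∀ p → Prime p → p ∤ P → p ∣ F →
      ∑ N (λ i → 𝟙 (p ∣? n i) * (F * u (n i))) ≤ u p * (F + A)
    upper p pp p∤P p∣F = begin
      ∑ N g                              ≤⟨ ∑-monoˡ-≤ g (m≤m*n N p) ⟩
      ∑ (N * p) g                        ≡⟨ ∑-blocks p N g ⟩
      ∑ N (λ b → ∑ p (λ i → g (b * p + i))) ≤⟨ ∑-mono N (λ b _ → ∑-atMostOne p (v b) (g≤v b) (one b)) ⟩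
      ∑ N v                              ≤⟨ ∑-monoˡ-≤ v (n≤1+n N) ⟩
      ∑ (1 + N) v                        ≡⟨ ∑-++ 1 N v ⟩
      u p * F + ∑ N (λ b → u p * u (suc b * P)) ≡⟨ cong (u p * F +_) (∑-*ˡ N (u p) _) ⟩
      u p * F + u p * A                  ≡⟨ *-distribˡ-+ (u p) F A ⟨
      u p * (F + A)                      ∎
      where
      open ≤-Reasoning
      instance
        p≢0 : NonZero p
        p≢0 = prime⇒nonZero pp
      1≤p : 1 ≤ p
      1≤p = >-nonZero⁻¹ p
      g v : ℕ → ℕ
      g i = 𝟙 (p ∣? n i) * (F * u (n i))
      v zero    = u p * F
      v (suc b) = u p * u (suc b * P)

      bound : ∀ b i → p ∣ n (b * p + i) → F * u (n (b * p + i)) ≤ v b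
      bound zero    i p∣n = begin
        F * u (n i)   ≤⟨ *-monoʳ-≤ F (unit-anti F 1≤p (∣⇒≤ {{>-nonZero (1≤n i)}} p∣n)) ⟩
        F * u p       ≡⟨ *-comm F (u p) ⟩
        u p * F       ∎
      bound (suc b) i p∣n = begin
        F * u (n (suc b * p + i))   ≤⟨ *-monoʳ-≤ F (unit-anti F (*-mono-≤ 1≤p 1≤bP) far) ⟩
        F * u (p * (suc b * P))     ≤⟨ unit-* F 1≤p 1≤bP p∣F ⟩
        u p * u (suc b * P)         ∎
        where
        1≤bP : 1 ≤ suc b * P
        1≤bP = ≤-trans (>-nonZero⁻¹ P) (m≤m+n P (b * P))
        split : ∀ ρ b p P i → ρ + suc (suc b * p + i) * P ≡ p * (suc b * P) + (ρ + suc i * P)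
        split = solve-∀
        far : p * (suc b * P) ≤ n (suc b * p + i)
        far = subst (p * (suc b * P) ≤_) (sym (split ρ b p P i)) (m≤m+n _ _)

      g≤v : ∀ b i → i < p → g (b * p + i) ≤ v b
      g≤v b i _ with p ∣? n (b * p + i)
      ... | yes p∣n = subst (_≤ v b) (sym (+-identityʳ _)) (bound b i p∣n)
      ... | no  _   = z≤n

      distinct : ∀ b {i j} → i < j → j < p → p ∣ n (b * p + i) → p ∤ n (b * p + j)
      distinct b {i} i<j j<p p∣ni p∣nj with m≤n⇒∃[o]m+o≡n (<⇒≤ i<j)
      ... | d , refl with euclidsLemma d P pp
                          (∣m+n∣m⇒∣n (subst (p ∣_) (split ρ (b * p) i d P) p∣nj) p∣ni)
        where
        split : ∀ ρ x i d P → ρ + suc (x + (i + d)) * P ≡ ρ + suc (x + i) * P + d * P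
        split = solve-∀
      ...   | inj₂ p∣P = p∤P p∣P
      ...   | inj₁ p∣d = >⇒∤ {{>-nonZero 0<d}} (≤-<-trans (m≤n+m d i) j<p) p∣d
        where
        0<d : 0 < d
        0<d = +-cancelˡ-< i 0 d (subst (_< i + d) (sym (+-identityʳ i)) i<j)

      one : ∀ b {i j} → i < j → j < p → g (b * p + i) ≡ 0 ⊎ g (b * p + j) ≡ 0
      one b {i} {j} i<j j<p with p ∣? n (b * p + i)
      ... | no  _   = inj₁ refl
      ... | yes p∣n = inj₂ (cong (_* (F * u (n (b * p + j))))
        (𝟙-no (p ∣? n (b * p + j)) (distinct b i<j j<p p∣n)))

    double-count : F * A ≤ F * F + S * (F + A)
    double-count = begin
      F * A                        ≤⟨ *-monoʳ-≤ F lower ⟩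
      F * (F + ∑ N (u ∘ n))        ≡⟨ *-distribˡ-+ F F _ ⟩
      F * F + F * ∑ N (u ∘ n)      ≡⟨ cong (F * F +_) (∑-*ˡ N F _) ⟨
      F * F + ∑ N (λ i → F * u (n i))  ≤⟨ +-monoʳ-≤ (F * F) (begin
        ∑ N (λ i → F * u (n i))      ≤⟨ ∑-mono N covered ⟩
        ∑ N (λ i → sum (map (λ p → 𝟙 (p ∣? n i) * (F * u (n i))) L))
          ≡⟨ ∑-sum-swap N (λ i p → 𝟙 (p ∣? n i) * (F * u (n i))) L ⟩
        sum (map (λ p → ∑ N (λ i → 𝟙 (p ∣? n i) * (F * u (n i)))) L)
          ≤⟨ sum-mono (All.zipWith (λ {p} ((pp , p∤P , _) , (_ , p∣F)) → upper p pp p∤P p∣F)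
               (All.all-filter Q? (upTo (suc X)) , L-factors)) ⟩
        sum (map (λ p → u p * (F + A)) L) ≡⟨ sum-*ʳ u (F + A) L ⟩
        S * (F + A)                  ∎) ⟩
      F * F + S * (F + A)          ∎
      where open ≤-Reasoning

    F≤2S : F ≤ 2 * S
    F≤2S = *-cancelˡ-≤ (2 * A) {{m*n≢0 2 A {{_}} {{A≢0}}}} (+-cancelˡ-≤ (F * A) _ _ (begin
      F * A + 2 * A * F                ≡⟨ collect F A ⟩
      3 * (F * A)                      ≤⟨ *-monoʳ-≤ 3 double-count ⟩
      3 * (F * F + S * (F + A))        ≡⟨ expand F A S ⟩
      F * (3 * F) + S * (3 * F + 3 * A)
        ≤⟨ +-mono-≤ (*-monoʳ-≤ F A-large) (*-monoʳ-≤ S (+-monoˡ-≤ (3 * A) A-large)) ⟩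
      F * A + S * (A + 3 * A)          ≡⟨ cong (F * A +_) (quadruple S A) ⟩
      F * A + 2 * A * (2 * S)          ∎))
      where
      open ≤-Reasoning
      A≢0 : NonZero A
      A≢0 = >-nonZero (≤-trans (*-mono-≤ {1} {3} (s≤s z≤n) (>-nonZero⁻¹ F)) A-large)
      collect : ∀ F A → F * A + 2 * A * F ≡ 3 * (F * A)
      collect = solve-∀
      expand : ∀ F A S → 3 * (F * F + S * (F + A)) ≡ F * (3 * F) + S * (3 * F + 3 * A)
      expand = solve-∀
      quadruple : ∀ S A → S * (A + 3 * A) ≡ 2 * A * (2 * S)
      quadruple = solve-∀

  -- Abstract, so that the list is never computed.
  abstract
    reciprocals≥½ : ∃[ L ] (All (λ p → Prime p × p ∤ P × B p) L × Unique L ×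
      product L ≤ 2 * reciprocals L)
    reciprocals≥½ = L , All.all-filter Q? (upTo (suc X)) , Unique.filter⁺ Q? (Unique.upTo⁺ (suc X)) ,
      *-cancelˡ-≤ F (begin
        F * product L            ≡⟨ *-comm F (product L) ⟩
        product L * F            ≤⟨ *-monoʳ-≤ (product L) F≤2S ⟩
        product L * (2 * S)      ≡⟨ swap (product L) S ⟩
        2 * (product L * S)      ≡⟨ cong (2 *_) (reciprocals-unit F L-factors) ⟨
        2 * (F * reciprocals L)  ≡⟨ swap F (reciprocals L) ⟨
        F * (2 * reciprocals L)  ∎)
      where
      open ≤-Reasoning
      swap : ∀ x y → x * (2 * y) ≡ 2 * (x * y)
      swap = solve-∀

-- Coprime residue classes

prime-coprime : ∀ {p n} → Prime p → p ∤ n → Coprime p n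
prime-coprime pp p∤n (d∣p , d∣n) with prime⇒irreducible pp d∣p
... | inj₁ d≡1  = d≡1
... | inj₂ refl = contradiction d∣n p∤n

coprime-* : ∀ {a b c} → Coprime a c → Coprime b c → Coprime (a * b) c
coprime-* a⊥c b⊥c (d∣ab , d∣c) =
  b⊥c (coprime-divisor (λ (x∣d , x∣a) → a⊥c (x∣a , ∣-trans x∣d d∣c)) d∣ab , d∣c)

-- P is a nonzero multiple of m, and the class of c modulo m contains a class
-- modulo P that is coprime to P.
record Refines (m c : ℕ) .{{_ : NonZero m}} (P : ℕ) : Set where
  field
    P≢0     : NonZero P
    m∣P     : m ∣ P
    r       : ℕ
    coprime : Coprime r P
    r≡c     : r % m ≡ c % m

refine-prime : ∀ {m c P p} .{{_ : NonZero m}} → Prime p → Refines m c P → Refines m c (p * P)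
refine-prime {m} {c} {P} {p} pp R = record
  { P≢0     = m*n≢0 p P {{prime⇒nonZero pp}} {{P≢0}}
  ; m∣P     = ∣n⇒∣m*n p m∣P
  ; r       = proj₁ r′
  ; coprime = Coprimality.sym (coprime-* (prime-coprime pp (proj₁ (proj₂ r′)))
                (Coprimality.sym (proj₁ (proj₂ (proj₂ r′)))))
  ; r≡c     = trans (proj₂ (proj₂ (proj₂ r′))) r≡c
  }
  where
  open Refines R
  r′ : ∃[ r′ ] (p ∤ r′ × Coprime r′ P × r′ % m ≡ r % m)
  r′ with p ∣? r
  ... | no  p∤r = r , p∤r , coprime , refl
  ... | yes p∣r = P + r ,
    (λ p∣P+r → ¬prime[1] (subst Prime (coprime (p∣r ,
      ∣m+n∣m⇒∣n (subst (p ∣_) (+-comm P r) p∣P+r) p∣r)) pp)) ,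
    Coprimality.coprime-+ coprime , %-remove-+ˡ r m∣P

refine-primes : ∀ {m c P L} .{{_ : NonZero m}} → All Prime L → Refines m c P →
  Refines m c (product L * P)
refine-primes {P = P} [] R = subst (Refines _ _) (sym (+-identityʳ P)) R
refine-primes {P = P} {p ∷ L} (pp ∷ primes) R =
  subst (Refines _ _) (sym (*-assoc p (product L) P)) (refine-prime pp (refine-primes primes R))

-- If every positive integer in the class of c modulo m has a prime factor in
-- B, then the primes in B that do not divide a given P as above have infinite
-- reciprocal sum.
module _ {m c : ℕ} .{{_ : NonZero m}} {B : Pred ℕ 0ℓ} (B? : Decidable B)
  (factor : ∀ n → 1 ≤ n → n % m ≡ c % m → ∃[ p ] (Prime p × p ∣ n × B p)) where

  private
    factor-mod-P : ∀ {P} (R : Refines m c P) → let open Refines R in ∀ n → 1 ≤ n →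
      _%_ n P {{P≢0}} ≡ _%_ r P {{P≢0}} → ∃[ p ] (Prime p × p ∣ n × p ∤ P × B p)
    factor-mod-P {P} R n 1≤n n≡r =
      let p , pp , p∣n , Bp = factor n 1≤n n≡c in p , pp , p∣n , p∤P pp p∣n , Bp
      where
      open Refines R
      open ≡-Reasoning
      instance
        P-nonZero : NonZero P
        P-nonZero = P≢0
      n≡c : n % m ≡ c % m
      n≡c = begin
        n % m        ≡⟨ m∣n⇒o%n%m≡o%m m P n m∣P ⟨
        n % P % m    ≡⟨ cong (_% m) n≡r ⟩
        r % P % m    ≡⟨ m∣n⇒o%n%m≡o%m m P r m∣P ⟩
        r % m        ≡⟨ r≡c ⟩
        c % m        ∎
      p∤P : ∀ {p} → Prime p → p ∣ n → p ∤ P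
      p∤P {p} pp p∣n p∣P = ¬prime[1] (subst Prime (coprime
        (∣n∣m%n⇒∣m p∣P (subst (p ∣_) n≡r (%-presˡ-∣ p∣n p∣P)) , p∣P)) pp)

  -- Each finite list with reciprocal sum at least 1/2 is followed by one whose
  -- primes do not divide the product of P and the earlier primes.
  reciprocals-diverge : ∀ {P} → Refines m c P → ∀ K →
    ∃[ L ] (All (λ p → Prime p × p ∤ P × B p) L × Unique L × K * product L ≤ 2 * reciprocals L)
  reciprocals-diverge         R zero    = [] , [] , [] , z≤n
  reciprocals-diverge {P} R (suc K)
    with L , good , unique , large ← reciprocals≥½ P (Refines.r R) {{Refines.P≢0 R}} B?
                                           (factor-mod-P R)
    with L′ , good′ , unique′ , large′ ←
           reciprocals-diverge (refine-primes (All.map proj₁ good) R) K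
    = L ++ L′ ,
      All.++⁺ good (All.map
        (λ (pp , p∤ , Bp) → pp , (λ p∣P → p∤ (∣n⇒∣m*n (product L) p∣P)) , Bp) good′) ,
      Unique.++⁺ unique unique′ (λ (x∈L , x∈L′) →
        proj₁ (proj₂ (All.lookup good′ x∈L′)) (∣m⇒∣m*n P (∈⇒∣product x∈L))) ,
      (begin
        suc K * product (L ++ L′)              ≡⟨ cong (suc K *_) (product-++ L L′) ⟩
        suc K * (product L * product L′)       ≡⟨ expand K (product L) (product L′) ⟩
        product L * product L′ + product L * (K * product L′)
          ≤⟨ +-mono-≤ (*-monoˡ-≤ (product L′) large) (*-monoʳ-≤ (product L) large′) ⟩
        2 * reciprocals L * product L′ + product L * (2 * reciprocals L′)
          ≡⟨ collect (product L) (product L′) (reciprocals L) (reciprocals L′) ⟩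
        2 * (reciprocals L * product L′ + product L * reciprocals L′)
          ≡⟨ cong (2 *_) (reciprocals-++ L L′) ⟨
        2 * reciprocals (L ++ L′)              ∎)
    where
    open ≤-Reasoning
    expand : ∀ K x y → suc K * (x * y) ≡ x * y + x * (K * y)
    expand = solve-∀
    collect : ∀ x y e f → 2 * e * y + x * (2 * f) ≡ 2 * (e * y + x * f)
    collect = solve-∀

-- Divisors in a given coprime residue class

module _ (m : ℕ) .{{_ : NonZero m}} where

  %-*ʳ : ∀ a b → (a * (b % m)) % m ≡ (a * b) % m
  %-*ʳ a b = begin
    (a * (b % m)) % m              ≡⟨ %-distribˡ-* a (b % m) m ⟩
    ((a % m) * (b % m % m)) % m    ≡⟨ cong (λ z → ((a % m) * z) % m) (m%n%n≡m%n b m) ⟩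
    ((a % m) * (b % m)) % m        ≡⟨ %-distribˡ-* a b m ⟨
    (a * b) % m                    ∎
    where open ≡-Reasoning

  toℕ-mod : ∀ a → toℕ (a mod m) ≡ a % m
  toℕ-mod a = toℕ-fromℕ< (m%n<n a m)

  mod-cong : ∀ {a b} → a % m ≡ b % m → a mod m ≡ b mod m
  mod-cong {a} {b} eq = toℕ-injective (trans (toℕ-mod a) (trans eq (sym (toℕ-mod b))))

  mod-injective : ∀ {a b} → a mod m ≡ b mod m → a % m ≡ b % m
  mod-injective {a} {b} eq = trans (sym (toℕ-mod a)) (trans (cong toℕ eq) (toℕ-mod b))

  toℕ-mod-inverse : ∀ (x : Fin m) → toℕ x mod m ≡ x
  toℕ-mod-inverse x = toℕ-injective (trans (toℕ-mod (toℕ x)) (m<n⇒m%n≡m (toℕ<n x)))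

  mod-*ʳ : ∀ a b → (a * toℕ (b mod m)) mod m ≡ (a * b) mod m
  mod-*ʳ a b = mod-cong (trans (cong (λ z → (a * z) % m) (toℕ-mod b)) (%-*ʳ a b))

  -- Multiplication by p does not preserve the set S of residues modulo m.
  Moves : Subset m → Pred ℕ 0ℓ
  Moves S p = ∃[ x ] (x ∈ₛ S × (p * toℕ x) mod m ∉ₛ S)

  Moves? : ∀ S → Decidable (Moves S)
  Moves? S p = any? λ x → x ∈? S ×-dec ¬? ((p * toℕ x) mod m ∈? S)

  -- If no prime in a list moves S, then their product does not either.
  moves-or-preserves : ∀ S {L} → All Prime L → (∃[ p ] (Prime p × p ∈ L × Moves S p)) ⊎
    (∀ s → s mod m ∈ₛ S → (product L * s) mod m ∈ₛ S)
  moves-or-preserves S [] = inj₂ λ s s∈S →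
    subst (λ z → z mod m ∈ₛ S) (sym (+-identityʳ s)) s∈S
  moves-or-preserves S {p ∷ L} (pp ∷ primes) with Moves? S p | moves-or-preserves S primes
  ... | yes moves | _ = inj₁ (p , pp , here refl , moves)
  ... | no _      | inj₁ (l , pl , l∈L , moves) = inj₁ (l , pl , there l∈L , moves)
  ... | no ¬moves | inj₂ preserves = inj₂ λ s s∈S →
    subst (_∈ₛ S) (trans (mod-*ʳ p (product L * s)) (cong (_mod m) (sym (*-assoc p (product L) s))))
      (decidable-stable (_ ∈? S) λ ∉S → ¬moves (_ , preserves s s∈S , ∉S))

  -- Some divisor e of k that is coprime to P multiplies some element of S to c.
  Reaches : ℕ → Subset m → ℕ → Pred ℕ 0ℓ
  Reaches c S P k = ∃[ e ] (e ∣ k × Coprime e P ×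
    ∃[ s ] (s mod m ∈ₛ S × (e * s) % m ≡ c % m))

  -- If c is reached from S together with p x by e, then it is reached from S
  -- by e or by e p.
  reaches-step : ∀ {c S P k p} → Prime p → p ∤ P → ∀ {x} → x ∈ₛ S → p ∣ k →
    Reaches c (S ∪ ⁅ (p * toℕ x) mod m ⁆) (p * P) k → Reaches c S P k
  reaches-step {c} {S} {P} {k} {p} pp p∤P {x} x∈S (divides j refl) (e , e∣k , e⊥pP , s , s∈ , es≡c)
    with x∈p∪q⁻ S ⁅ (p * toℕ x) mod m ⁆ s∈
  ... | inj₁ s∈S = e , e∣k , e⊥P , s , s∈S , es≡c
    where
    e⊥P : Coprime e P
    e⊥P (d∣e , d∣P) = e⊥pP (d∣e , ∣n⇒∣m*n p d∣P)
  ... | inj₂ s∈⁅px⁆ = e * p , *-monoˡ-∣ p e∣j , coprime-* e⊥P (prime-coprime pp p∤P) ,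
    toℕ x , subst (_∈ₛ S) (sym (toℕ-mod-inverse x)) x∈S , (begin
      (e * p * toℕ x) % m          ≡⟨ cong (_% m) (*-assoc e p (toℕ x)) ⟩
      (e * (p * toℕ x)) % m        ≡⟨ %-*ʳ e (p * toℕ x) ⟨
      (e * ((p * toℕ x) % m)) % m  ≡⟨ cong (λ z → (e * z) % m) (mod-injective (x∈⁅y⁆⇒x≡y _ s∈⁅px⁆)) ⟨
      (e * (s % m)) % m            ≡⟨ %-*ʳ e s ⟩
      (e * s) % m                  ≡⟨ es≡c ⟩
      c % m                        ∎)
    where
    open ≡-Reasoning
    e⊥P : Coprime e P
    e⊥P (d∣e , d∣P) = e⊥pP (d∣e , ∣n⇒∣m*n p d∣P)
    e∣j : e ∣ j
    e∣j = coprime-divisor {n = p} (λ (d∣e , d∣p) → e⊥pP (d∣e , ∣m⇒∣m*n P d∣p))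
      (subst (e ∣_) (*-comm j p) e∣k)

  -- By induction on the complement of S.  If S does not contain c, then every n
  -- in the class of c moves 1 out of S and so has a prime factor that moves S.
  -- Such primes have infinite reciprocal sum, so almost every k is divisible by
  -- one of them, and adding p x to S makes the induction hypothesis applicable.
  almostAll-reach : ∀ c S → Acc _⊃_ S → 1 mod m ∈ₛ S → ∀ P → Refines m c P →
    AlmostAll (Reaches c S P)
  almostAll-reach c S (acc rec) 1∈S P R with c mod m ∈? S
  ... | yes c∈S = always {Reaches c S P} λ k _ →
    1 , (1∣ k) , Coprimality.1-coprimeTo P , c , c∈S , cong (_% m) (+-identityʳ c)
  ... | no  c∉S = λ t →
    let L , good , unique , large = reciprocals-diverge (Moves? S) factor R (8 * t)
    in allBut-map t (λ k _ (divisor , reach) → combine divisor reach)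
         (allBut-∩ t
           (allBut-prime-divisor (All.map proj₁ good) unique (2 * t) (enough t large))
           (almostAll-List (All.map (λ (pp , p∤P , moves) → extend pp p∤P moves) good) (2 * t)))
    where
    factor : ∀ n → 1 ≤ n → n % m ≡ c % m → ∃[ p ] (Prime p × p ∣ n × Moves S p)
    factor n 1≤n n≡c with factorise n {{>-nonZero 1≤n}}
    ... | record { factors = ps ; isFactorisation = refl ; factorsPrime = primes }
      with moves-or-preserves S primes
    ...   | inj₁ (p , pp , p∈ps , moves) = p , pp , ∈⇒∣product p∈ps , moves
    ...   | inj₂ preserves = contradiction
      (subst (_∈ₛ S) (trans (cong (_mod m) (*-identityʳ (product ps))) (mod-cong n≡c))
        (preserves 1 1∈S)) c∉S

    -- To leave out a proportion 1 / (2 t), the sieve needs reciprocal sum 4 t, which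
    -- reciprocals-diverge reaches in 8 t steps of 1/2.
    enough : ∀ t {x y} → 8 * t * x ≤ 2 * y → 2 * (2 * t) * x ≤ y
    enough t {x} {y} le = *-cancelˡ-≤ 2 (subst (_≤ 2 * y) (rearrange t x) le)
      where
      rearrange : ∀ t x → 8 * t * x ≡ 2 * (2 * (2 * t) * x)
      rearrange = solve-∀

    extend : ∀ {p} → Prime p → p ∤ P → Moves S p →
      AlmostAll (λ k → p ∣ k → Reaches c S P k)
    extend {p} pp p∤P (x , x∈S , px∉S) = almostAll-map
      (λ k _ reach p∣k → reaches-step pp p∤P x∈S p∣k reach)
      (almostAll-reach c S′ (rec (p⊆p∪q ⁅y⁆ , y , q⊆p∪q S ⁅y⁆ (x∈⁅x⁆ y) , px∉S))
        (p⊆p∪q ⁅y⁆ 1∈S) (p * P) (refine-prime pp R))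
      where
      y = (p * toℕ x) mod m
      ⁅y⁆ = ⁅ y ⁆
      S′ = S ∪ ⁅y⁆

    combine : ∀ {k L} → Any (_∣ k) L → All (λ p → p ∣ k → Reaches c S P k) L →
      Reaches c S P k
    combine (here p∣k)  (f ∷ _)  = f p∣k
    combine (there any) (_ ∷ fs) = combine any fs

  almostAll-divisor : ∀ c → Coprime c m → AlmostAll (λ k → ∃[ e ] (e ∣ k × e % m ≡ c % m))
  almostAll-divisor c c⊥m = almostAll-map
    (λ k _ (e , e∣k , _ , s , s∈ , es≡c) → e , e∣k , (begin
      e % m              ≡⟨ cong (_% m) (*-identityʳ e) ⟨
      (e * 1) % m        ≡⟨ %-*ʳ e 1 ⟨
      (e * (1 % m)) % m  ≡⟨ cong (λ z → (e * z) % m) (mod-injective (x∈⁅y⁆⇒x≡y _ s∈)) ⟨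
      (e * (s % m)) % m  ≡⟨ %-*ʳ e s ⟩
      (e * s) % m        ≡⟨ es≡c ⟩
      c % m              ∎))
    (almostAll-reach c ⁅ 1 mod m ⁆ (⊃-wellFounded _) (x∈⁅x⁆ (1 mod m)) m record
      { P≢0 = >-nonZero (>-nonZero⁻¹ m) ; m∣P = ∣-refl ; r = c ; coprime = c⊥m ; r≡c = refl })
    where open ≡-Reasoning

-- Congruences

mod⇒% : ∀ {d x y} .{{_ : NonZero d}} → x ≡ y [mod d ] → x % d ≡ y % d
mod⇒% {d} {x} {y} x≡y with ≤-total x y
... | inj₁ x≤y = sym (trans (cong (_% d) (sym (m+[n∸m]≡n x≤y)))
  (%-remove-+ʳ x (subst (d ∣_) (m≤n⇒∣m-n∣≡n∸m x≤y) x≡y)))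
... | inj₂ y≤x = trans (cong (_% d) (sym (m+[n∸m]≡n y≤x)))
  (%-remove-+ʳ y (subst (d ∣_) (m≤n⇒∣n-m∣≡n∸m y≤x) x≡y))

%⇒mod : ∀ {d x y} .{{_ : NonZero d}} → x % d ≡ y % d → x ≡ y [mod d ]
%⇒mod {d} {x} {y} eq = subst (d ∣_) (begin
  ∣ x ÷ d - y ÷ d ∣ * d                           ≡⟨ *-distribʳ-∣-∣ d (x ÷ d) (y ÷ d) ⟩
  ∣ x ÷ d * d - y ÷ d * d ∣                       ≡⟨ ∣m+n-m+o∣≡∣n-o∣ (x % d) _ _ ⟨
  ∣ x % d + x ÷ d * d - x % d + y ÷ d * d ∣
    ≡⟨ cong (λ r → ∣ x % d + x ÷ d * d - r + y ÷ d * d ∣) eq ⟩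
  ∣ x % d + x ÷ d * d - y % d + y ÷ d * d ∣
    ≡⟨ cong₂ ∣_-_∣ (m≡m%n+[m/n]*n x d) (m≡m%n+[m/n]*n y d) ⟨
  ∣ x - y ∣                                       ∎) (n∣m*n ∣ x ÷ d - y ÷ d ∣)
  where open ≡-Reasoning

mod-sym : ∀ {d} x y → x ≡ y [mod d ] → y ≡ x [mod d ]
mod-sym {d} x y = subst (d ∣_) (∣-∣-comm x y)

mod-trans : ∀ {d} x y z .{{_ : NonZero d}} → x ≡ y [mod d ] → y ≡ z [mod d ] → x ≡ z [mod d ]
mod-trans x y z x≡y y≡z = %⇒mod (trans (mod⇒% {x = x} {y} x≡y) (mod⇒% {x = y} {z} y≡z))

-- Multiplying a congruence and its modulus.
mod-*ˡ : ∀ {d} k x y → x ≡ y [mod d ] → k * x ≡ k * y [mod k * d ]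
mod-*ˡ {d} k x y x≡y = subst (k * d ∣_) (*-distribˡ-∣-∣ k x y) (*-monoʳ-∣ k x≡y)

mod-*-cancelˡ : ∀ {d} k x y .{{_ : NonZero k}} → k * x ≡ k * y [mod k * d ] → x ≡ y [mod d ]
mod-*-cancelˡ {d} k x y kx≡ky =
  *-cancelˡ-∣ k (subst (k * d ∣_) (sym (*-distribˡ-∣-∣ k x y)) kx≡ky)

mod-coprime-cancelˡ : ∀ {d} k x y → Coprime d k → k * x ≡ k * y [mod d ] → x ≡ y [mod d ]
mod-coprime-cancelˡ {d} k x y d⊥k kx≡ky =
  coprime-divisor d⊥k (subst (d ∣_) (sym (*-distribˡ-∣-∣ k x y)) kx≡ky)

mod-∣ : ∀ {d} x y → x ≡ y [mod d ] → d ∣ y → d ∣ x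
mod-∣ {zero}  x y x≡y 0∣y rewrite 0∣⇒≡0 0∣y | ∣-∣-identityʳ x = x≡y
mod-∣ {suc d} x y x≡y d∣y = m%n≡0⇒n∣m x (suc d)
  (trans (mod⇒% {x = x} {y} x≡y) (n∣m⇒m%n≡0 y (suc d) d∣y))

-- Counting

∑-suc : ∀ n f → ∑ (suc n) f ≡ f 0 + ∑ n (f ∘ suc)
∑-suc n f = ∑-++ 1 n f

length-filter : {P : Pred ℕ 0ℓ} (P? : Decidable P) (f : ℕ → ℕ) → ∀ n →
  length (filter P? (applyUpTo f n)) ≡ ∑ n (λ i → 𝟙 (P? (f i)))
length-filter P? f zero    = refl
length-filter P? f (suc n) rewrite ∑-suc n (λ i → 𝟙 (P? (f i)))
  with P? (f 0)
... | yes _ = cong suc (length-filter P? (f ∘ suc) n)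
... | no  _ = length-filter P? (f ∘ suc) n

count≡∑ : {P : Pred ℕ 0ℓ} (P? : Decidable P) → ∀ n → count P? n ≡ ∑ n (λ i → 𝟙 (P? (suc i)))
count≡∑ P? = length-filter P? suc

𝟙-mono : {A B : Set} (a : Dec A) (b : Dec B) → (A → B) → 𝟙 a ≤ 𝟙 b
𝟙-mono (yes a) b A→B = ≤-reflexive (sym (𝟙-yes b (A→B a)))
𝟙-mono (no _)  b A→B = z≤n

𝟙-cong : {A B : Set} (a : Dec A) (b : Dec B) → (A → B) → (B → A) → 𝟙 a ≡ 𝟙 b
𝟙-cong a b A→B B→A = ≤-antisym (𝟙-mono a b A→B) (𝟙-mono b a B→A)

𝟙≤1 : {A : Set} (a : Dec A) → 𝟙 a ≤ 1
𝟙≤1 (yes _) = ≤-refl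
𝟙≤1 (no _)  = z≤n

𝟙-union : {A B C : Set} (a : Dec A) (b : Dec B) (c : Dec C) →
  (A → B ⊎ C) → 𝟙 a ≤ 𝟙 b + 𝟙 c
𝟙-union (no _)  b       c A→B⊎C = z≤n
𝟙-union (yes a) (yes _) c A→B⊎C = s≤s z≤n
𝟙-union (yes a) (no ¬b) c A→B⊎C with A→B⊎C a
... | inj₁ b  = contradiction b ¬b
... | inj₂ c′ = ≤-reflexive (sym (𝟙-yes c c′))

𝟙-cases : {A B C D : Set} (a : Dec A) (b : Dec B) (c : Dec C) (d : Dec D) →
  (A → B ⊎ C ⊎ D) → 𝟙 a ≤ 𝟙 b + (𝟙 c + 𝟙 d)
𝟙-cases a b c d A→B⊎C⊎D = ≤-trans (𝟙-union a b (c ⊎-dec d) A→B⊎C⊎D)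
  (+-monoʳ-≤ (𝟙 b) (𝟙-union (c ⊎-dec d) c d (λ c⊎d → c⊎d)))

-- Two subsets of C overlap only where E is positive.
𝟙-overlap : {A B C : Set} (a : Dec A) (b : Dec B) (c : Dec C) {E : ℕ} →
  (A → C) → (B → C) → (A → B → E ≢ 0) → 𝟙 a + 𝟙 b ≤ 𝟙 c + E
𝟙-overlap (no _)  b       c A→C B→C disjoint = ≤-trans (𝟙-mono b c B→C) (m≤m+n _ _)
𝟙-overlap (yes a) (no _)  c A→C B→C disjoint = ≤-trans (𝟙-mono (yes a) c A→C) (m≤m+n _ _)
𝟙-overlap (yes a) (yes b) c A→C B→C disjoint =
  +-mono-≤ (𝟙-mono (yes a) c A→C) (n≢0⇒n>0 (disjoint a b))

-- The number of n in {1, …, x} with n ≡ r [mod d ].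
residueCount : ℕ → ℕ → ℕ → ℕ
residueCount d r x = ∑ x (λ i → 𝟙 (d ∣? ∣ suc i - r ∣))

-- Shifting by an s congruent to - r turns the residue class into multiples.
residueCount-shift : ∀ d r x .{{_ : NonZero d}} →
  ∃[ s ] (s < d × ∃[ ρ ] (ρ < d × s + x ≡ ρ + d * residueCount d r x))
residueCount-shift d r x =
  let ρ , ρ<d , eq = ∑-hits d s x s<d
  in s , s<d , ρ , ρ<d , trans eq (cong (λ z → ρ + d * z) (∑-cong x λ i _ →
       𝟙-cong (d ∣? (s + suc i)) (d ∣? ∣ suc i - r ∣) (hit⇒≡ (suc i)) (≡⇒hit (suc i))))
  where
  open ≡-Reasoning
  s = (pred d * r) % d
  s<d : s < d
  s<d = m%n<n (pred d * r) d
  d∣s+r : d ∣ s + r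
  d∣s+r = m%n≡0⇒n∣m (s + r) d (begin
    (s + r) % d                 ≡⟨ %-distribˡ-+ s r d ⟩
    (s % d + r % d) % d         ≡⟨ cong (λ z → (z + r % d) % d) (m%n%n≡m%n (pred d * r) d) ⟩
    (s + r % d) % d             ≡⟨ %-distribˡ-+ (pred d * r) r d ⟨
    (pred d * r + r) % d        ≡⟨ cong (_% d) (+-comm (pred d * r) r) ⟩
    (suc (pred d) * r) % d      ≡⟨ cong (λ z → (z * r) % d) (suc-pred d) ⟩
    (d * r) % d                 ≡⟨ cong (_% d) (*-comm d r) ⟩
    (r * d) % d                 ≡⟨ m*n%n≡0 r d ⟩
    0                           ∎)
  ≡⇒hit : ∀ n → n ≡ r [mod d ] → d ∣ s + n
  ≡⇒hit n n≡r = mod-∣ (s + n) (s + r) (subst (d ∣_) (sym (∣m+n-m+o∣≡∣n-o∣ s n r)) n≡r) d∣s+r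
  hit⇒≡ : ∀ n → d ∣ s + n → n ≡ r [mod d ]
  hit⇒≡ n d∣s+n = subst (d ∣_) (∣m+n-m+o∣≡∣n-o∣ s n r)
    (%⇒mod {x = s + n} {s + r} (trans (n∣m⇒m%n≡0 _ d d∣s+n) (sym (n∣m⇒m%n≡0 _ d d∣s+r))))

residueCount-≤ : ∀ d r x .{{_ : NonZero d}} → d * residueCount d r x ≤ x + d
residueCount-≤ d r x with s , s<d , ρ , _ , eq ← residueCount-shift d r x = begin
  d * residueCount d r x      ≤⟨ m≤n+m _ ρ ⟩
  ρ + d * residueCount d r x  ≡⟨ eq ⟨
  s + x                       ≤⟨ +-monoˡ-≤ x (<⇒≤ s<d) ⟩
  d + x                       ≡⟨ +-comm d x ⟩
  x + d                       ∎
  where open ≤-Reasoning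

residueCount-≥ : ∀ d r x .{{_ : NonZero d}} → x ≤ d * residueCount d r x + d
residueCount-≥ d r x with s , _ , ρ , ρ<d , eq ← residueCount-shift d r x = begin
  x                           ≤⟨ m≤n+m x s ⟩
  s + x                       ≡⟨ eq ⟩
  ρ + d * residueCount d r x  ≤⟨ +-monoˡ-≤ _ (<⇒≤ ρ<d) ⟩
  d + d * residueCount d r x  ≡⟨ +-comm d _ ⟩
  d * residueCount d r x + d  ∎
  where open ≤-Reasoning

-- Factorisations

-- A factorisation k = f e with e in the class of c such that neither q e nor
-- q f is 1.
Splits : ℕ → ℕ → ℕ → Pred ℕ 0ℓ
Splits q m c k = ∃[ e ] ∃[ f ] ((k ≡ f * e) × (e ≡ c [mod m ]) × q * e ≢ 1 × q * f ≢ 1)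

coprime-1+* : ∀ μ j → Coprime (1 + j * μ) (μ * μ)
coprime-1+* μ j = Coprimality.sym (coprime-* μ⊥ μ⊥)
  where
  μ⊥ : Coprime μ (1 + j * μ)
  μ⊥ {d} (d∣μ , d∣1+jμ) =
    ∣1⇒≡1 (∣m+n∣m⇒∣n (subst (d ∣_) (+-comm 1 (j * μ)) d∣1+jμ) (∣n⇒∣m*n j d∣μ))

-- For q = 1 the factors must differ from 1.  Two divisors in distinct classes
-- 1 + μ and 1 + 2 μ modulo μ * μ, where μ = 3 m, are distinct, differ from 1
-- and are 1 modulo m; at least one of them is not k.  The factor 3 makes the
-- residues 1, 1 + μ and 1 + 2 μ distinct even for m = 1.
almostAll-splits-1 : ∀ m .{{_ : NonZero m}} → AlmostAll (Splits 1 m 1)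
almostAll-splits-1 m t = allBut-map t split
  (allBut-∩ t (almostAll-divisor (μ * μ) (1 + 1 * μ) (coprime-1+* μ 1) (2 * t))
              (almostAll-divisor (μ * μ) (1 + 2 * μ) (coprime-1+* μ 2) (2 * t)))
  where
  μ = 3 * m
  instance
    μ≢0 : NonZero μ
    μ≢0 = m*n≢0 3 m
    μμ≢0 : NonZero (μ * μ)
    μμ≢0 = m*n≢0 μ μ

  1+2μ<μμ : 1 + 2 * μ < μ * μ
  1+2μ<μμ = begin-strict
    1 + 2 * μ    <⟨ +-monoˡ-< (2 * μ) (≤-trans (s≤s (s≤s z≤n)) (*-monoʳ-≤ 3 (>-nonZero⁻¹ m))) ⟩
    3 * μ        ≤⟨ *-monoˡ-≤ μ (*-monoʳ-≤ 3 (>-nonZero⁻¹ m)) ⟩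
    μ * μ        ∎
    where open ≤-Reasoning

  residue : ∀ j → j ≤ 2 → (1 + j * μ) % (μ * μ) ≡ 1 + j * μ
  residue j j≤2 = m<n⇒m%n≡m (≤-<-trans (s≤s (*-monoˡ-≤ μ j≤2)) 1+2μ<μμ)

  distinct : ∀ i j e f → i < j → j ≤ 2 → e % (μ * μ) ≡ (1 + i * μ) % (μ * μ) →
    f % (μ * μ) ≡ (1 + j * μ) % (μ * μ) → e ≢ f
  distinct i j e f i<j j≤2 e≡ f≡ refl = <⇒≢ (s<s (*-monoˡ-< μ i<j)) (begin
    1 + i * μ               ≡⟨ residue i (≤-trans (<⇒≤ i<j) j≤2) ⟨
    (1 + i * μ) % (μ * μ)   ≡⟨ e≡ ⟨
    e % (μ * μ)             ≡⟨ f≡ ⟩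
    (1 + j * μ) % (μ * μ)   ≡⟨ residue j j≤2 ⟩
    1 + j * μ               ∎)
    where open ≡-Reasoning

  ≡1 : ∀ j e → e % (μ * μ) ≡ (1 + j * μ) % (μ * μ) → e ≡ 1 [mod m ]
  ≡1 j e e≡ = %⇒mod {x = e} {1} (begin
    e % m                          ≡⟨ m∣n⇒o%n%m≡o%m m (μ * μ) e m∣μμ ⟨
    e % (μ * μ) % m                ≡⟨ cong (_% m) e≡ ⟩
    (1 + j * μ) % (μ * μ) % m      ≡⟨ m∣n⇒o%n%m≡o%m m (μ * μ) (1 + j * μ) m∣μμ ⟩
    (1 + j * μ) % m                ≡⟨ %-remove-+ʳ 1 (∣n⇒∣m*n j (n∣m*n 3)) ⟩
    1 % m                          ∎)
    where
    open ≡-Reasoning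
    m∣μμ : m ∣ μ * μ
    m∣μμ = ∣m⇒∣m*n μ (n∣m*n 3)

  split : ∀ k → 1 ≤ k → (∃[ e ] (e ∣ k × e % (μ * μ) ≡ (1 + 1 * μ) % (μ * μ))) ×
    (∃[ e ] (e ∣ k × e % (μ * μ) ≡ (1 + 2 * μ) % (μ * μ))) → Splits 1 m 1 k
  split k _ ((e , divides f k≡fe , e≡) , (e′ , divides f′ k≡f′e′ , e′≡)) with f ≟ 1
  ... | no f≢1 = e , f , k≡fe , ≡1 1 e e≡ ,
    (λ 1*e≡1 → distinct 0 1 1 e z<s (s≤s z≤n) refl e≡ (trans (sym 1*e≡1) (*-identityˡ e))) ,
    (λ 1*f≡1 → f≢1 (trans (sym (*-identityˡ f)) 1*f≡1))
  ... | yes refl = e′ , f′ , k≡f′e′ , ≡1 2 e′ e′≡ ,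
    (λ 1*e′≡1 → distinct 0 2 1 e′ z<s ≤-refl refl e′≡ (trans (sym 1*e′≡1) (*-identityˡ e′))) ,
    (λ 1*f′≡1 → distinct 1 2 e e′ (s<s z<s) ≤-refl e≡ e′≡ (begin
      e          ≡⟨ *-identityˡ e ⟨
      1 * e      ≡⟨ k≡fe ⟨
      k          ≡⟨ k≡f′e′ ⟩
      f′ * e′    ≡⟨ cong (_* e′) (trans (sym (*-identityˡ f′)) 1*f′≡1) ⟩
      1 * e′     ≡⟨ *-identityˡ e′ ⟩
      e′         ∎))
    where open ≡-Reasoning

almostAll-splits : ∀ q m c .{{_ : NonZero m}} → q * c ≡ 1 [mod m ] → AlmostAll (Splits q m c)
almostAll-splits q m c qc≡1 with q ≟ 1
... | yes refl = almostAll-map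
  (λ k _ (e , f , k≡ , e≡1 , rest) → e , f , k≡ ,
    mod-trans e 1 c e≡1 (mod-sym c 1 (subst (_≡ 1 [mod m ]) (*-identityˡ c) qc≡1)) , rest)
  (almostAll-splits-1 m)
... | no q≢1 = almostAll-map
  (λ k _ (e , (divides f k≡fe) , e≡c) → e , f , k≡fe , %⇒mod {x = e} {c} e≡c ,
    (λ qe≡1 → q≢1 (m*n≡1⇒m≡1 q e qe≡1)) , (λ qf≡1 → q≢1 (m*n≡1⇒m≡1 q f qf≡1)))
  (almostAll-divisor m c c⊥m)
  where
  c⊥m : Coprime c m
  c⊥m {d} (d∣c , d∣m) = ∣1⇒≡1 (∣n∣m%n⇒∣m d∣m
    (subst (d ∣_) (mod⇒% {x = q * c} {1} qc≡1) (%-presˡ-∣ (∣n⇒∣m*n q d∣c) d∣m)))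

-- From inequalities of integers to the density

open import Data.Integer.Base as ℤ using (+_; +0; +[1+_])

-- Below, T is the number of elements of the monoid up to x, A that of atoms, R
-- that of integers in the class of a * a modulo q b, and X bounds the number of
-- exceptional elements, those of the latter class that may be atoms.  If x is
-- large and X is a small proportion of it, then T exceeds d X + 3 d.
large-T : ∀ {T X x b d} .{{_ : NonZero b}} → 2 * b * d * X ≤ x → 6 * b * d + 2 * b < x →
  x ≤ b * T + b → d * X + 3 * d < T
large-T {T} {X} {x} {b} {d} X-small x-large x≤ = *-cancelˡ-< (2 * b) _ _ (
  +-cancelʳ-< (2 * b) _ _ (begin-strict
  2 * b * (d * X + 3 * d) + 2 * b           ≡⟨ expand b d X ⟩
  2 * b * d * X + (6 * b * d + 2 * b)       <⟨ +-mono-≤-< X-small x-large ⟩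
  x + x                                     ≤⟨ +-mono-≤ x≤ x≤ ⟩
  (b * T + b) + (b * T + b)                 ≡⟨ collect b T ⟩
  2 * b * T + 2 * b                         ∎))
  where
  open ≤-Reasoning
  expand : ∀ b d X → 2 * b * (d * X + 3 * d) + 2 * b ≡ 2 * b * d * X + (6 * b * d + 2 * b)
  expand = solve-∀
  collect : ∀ b T → (b * T + b) + (b * T + b) ≡ 2 * b * T + 2 * b
  collect = solve-∀

-- Once T is that large, A / T is within 1/d of 1 - 1/q: few-nonatoms bounds it
-- from below and few-atoms from above.
module _ {A T R X x q b d : ℕ} .{{_ : NonZero q}} .{{_ : NonZero b}} where

  few-nonatoms : T ≤ A + (1 + R) → q * b * R ≤ x + q * b → x ≤ b * T + b →
    d * X + 3 * d < T → d * (q * T) < d * (q * A + T) + q * T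
  few-nonatoms T≤ R≤ x≤ large = *-cancelˡ-< b _ _ (begin-strict
    b * (d * (q * T))                            ≤⟨ *-monoʳ-≤ b (*-monoʳ-≤ d (*-monoʳ-≤ q T≤)) ⟩
    b * (d * (q * (A + (1 + R))))                ≡⟨ expand b d q A R ⟩
    b * (d * (q * A + q)) + d * (q * b * R)      ≤⟨ +-monoʳ-≤ (b * (d * (q * A + q))) (*-monoʳ-≤ d R≤) ⟩
    b * (d * (q * A + q)) + d * (x + q * b)
      ≤⟨ +-monoʳ-≤ (b * (d * (q * A + q))) (*-monoʳ-≤ d (+-monoˡ-≤ (q * b) x≤)) ⟩
    b * (d * (q * A + q)) + d * (b * T + b + q * b) ≡⟨ collect b d q A T ⟩
    b * (d * (q * A + T)) + b * (2 * (q * d) + d)   <⟨ +-monoʳ-< _ (*-monoʳ-< b rest) ⟩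
    b * (d * (q * A + T)) + b * (q * T)          ≡⟨ *-distribˡ-+ b _ _ ⟨
    b * (d * (q * A + T) + q * T)                ∎)
    where
    open ≤-Reasoning
    expand : ∀ b d q A R → b * (d * (q * (A + (1 + R)))) ≡ b * (d * (q * A + q)) + d * (q * b * R)
    expand = solve-∀
    collect : ∀ b d q A T → b * (d * (q * A + q)) + d * (b * T + b + q * b) ≡
      b * (d * (q * A + T)) + b * (2 * (q * d) + d)
    collect = solve-∀
    triple : ∀ q d → 2 * (q * d) + q * d ≡ q * (3 * d)
    triple = solve-∀
    rest : 2 * (q * d) + d < q * T
    rest = begin-strict
      2 * (q * d) + d          ≤⟨ +-monoʳ-≤ (2 * (q * d)) (m≤n*m d q) ⟩
      2 * (q * d) + q * d      ≡⟨ triple q d ⟩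
      q * (3 * d)              <⟨ *-monoʳ-< q (≤-<-trans (m≤n+m (3 * d) (d * X)) large) ⟩
      q * T                    ∎

  few-atoms : A + R ≤ T + X → b * T ≤ x + 2 * b → x ≤ q * b * R + q * b →
    d * X + 3 * d < T → d * (q * A + T) < d * (q * T) + q * T
  few-atoms A+R≤ T≤ x≤ large = *-cancelˡ-< b _ _ (+-cancelʳ-< (d * (q * b * R)) _ _ (begin-strict
    b * (d * (q * A + T)) + d * (q * b * R)         ≡⟨ expand b d q A T R ⟩
    b * d * q * (A + R) + d * (b * T)
      ≤⟨ +-mono-≤ (*-monoʳ-≤ (b * d * q) A+R≤) (*-monoʳ-≤ d T≤) ⟩
    b * d * q * (T + X) + d * (x + 2 * b)
      ≤⟨ +-monoʳ-≤ (b * d * q * (T + X)) (*-monoʳ-≤ d (+-monoˡ-≤ (2 * b) x≤)) ⟩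
    b * d * q * (T + X) + d * (q * b * R + q * b + 2 * b)  ≡⟨ collect b d q T X R ⟩
    b * (d * (q * T) + (q * (d * X + d) + 2 * d)) + d * (q * b * R)
      <⟨ +-monoˡ-< (d * (q * b * R)) (*-monoʳ-< b (+-monoʳ-< (d * (q * T)) rest)) ⟩
    b * (d * (q * T) + q * T) + d * (q * b * R)     ∎))
    where
    open ≤-Reasoning
    expand : ∀ b d q A T R → b * (d * (q * A + T)) + d * (q * b * R) ≡
      b * d * q * (A + R) + d * (b * T)
    expand = solve-∀
    collect : ∀ b d q T X R → b * d * q * (T + X) + d * (q * b * R + q * b + 2 * b) ≡
      b * (d * (q * T) + (q * (d * X + d) + 2 * d)) + d * (q * b * R)
    collect = solve-∀
    triple : ∀ q d X → q * (d * X + d) + q * (2 * d) ≡ q * (d * X + 3 * d)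
    triple = solve-∀
    rest : q * (d * X + d) + 2 * d < q * T
    rest = begin-strict
      q * (d * X + d) + 2 * d        ≤⟨ +-monoʳ-≤ (q * (d * X + d)) (m≤n*m (2 * d) q) ⟩
      q * (d * X + d) + q * (2 * d)  ≡⟨ triple q d X ⟩
      q * (d * X + 3 * d)            <⟨ *-monoʳ-< q large ⟩
      q * T                          ∎

∣∣<-intro : ∀ x {ε} → x ℚ.< ε → ℚ.- x ℚ.< ε → ℚ.∣ x ∣ ℚ.< ε
∣∣<-intro x x<ε -x<ε with ℚ.∣p∣≡p∨∣p∣≡-p x
... | inj₁ eq = subst (ℚ._< _) (sym eq) x<ε
... | inj₂ eq = subst (ℚ._< _) (sym eq) -x<ε

-- The two inequalities say that |A / T - (1 - 1/q)| < 1/d, where d is the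
-- denominator of ε.
ratio-close : ∀ A T q .{{_ : NonZero T}} .{{_ : NonZero q}} ε → 0ℚ ℚ.< ε →
  let d = ℚ.↧ₙ ε in
  d * (q * A + T) < d * (q * T) + q * T →
  d * (q * T) < d * (q * A + T) + q * T →
  ℚ.∣ (+ A / T) ℚ.- (1ℚ ℚ.- (+ 1 / q)) ∣ ℚ.< ε
ratio-close A T q (mkℚ (+0) _ _) (ℚ.*<* (ℤ.+<+ ()))
ratio-close A T@(suc T-1) q@(suc q-1) ε@(mkℚ +[1+ n ] d-1 _) _ above below =
  ∣∣<-intro δ
    (ℚ.toℚᵘ-cancel-< (ℚᵘ.<-respˡ-≃ (ℚᵘ.≃-sym δ≃δᵘ) (ℚᵘ.*<* above′)))
    (ℚ.toℚᵘ-cancel-< (ℚᵘ.<-respˡ-≃ (ℚᵘ.≃-sym (ℚᵘ.≃-trans (ℚ.toℚᵘ-homo‿- δ) (ℚᵘ.-‿cong δ≃δᵘ)))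
      (ℚᵘ.*<* below′)))
  where
  d = suc d-1
  δ = (+ A / T) ℚ.- (1ℚ ℚ.- (+ 1 / q))
  δᵘ = mkℚᵘ (+ A) T-1 ℚᵘ.- (1ℚᵘ ℚᵘ.- mkℚᵘ (+ 1) q-1)

  homo-- : ∀ x y → toℚᵘ (x ℚ.- y) ℚᵘ.≃ toℚᵘ x ℚᵘ.- toℚᵘ y
  homo-- x y = ℚᵘ.≃-trans (ℚ.toℚᵘ-homo-+ x (ℚ.- y)) (ℚᵘ.+-congʳ (toℚᵘ x) (ℚ.toℚᵘ-homo‿- y))

  δ≃δᵘ : toℚᵘ δ ℚᵘ.≃ δᵘ
  δ≃δᵘ = ℚᵘ.≃-trans (homo-- (+ A / T) (1ℚ ℚ.- (+ 1 / q)))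
    (ℚᵘ.+-cong (ℚ.toℚᵘ-fromℚᵘ (mkℚᵘ (+ A) T-1))
      (ℚᵘ.-‿cong (ℚᵘ.≃-trans (homo-- 1ℚ (+ 1 / q))
        (ℚᵘ.+-congʳ 1ℚᵘ (ℚᵘ.-‿cong (ℚ.toℚᵘ-fromℚᵘ (mkℚᵘ (+ 1) q-1)))))))

  numerator : ∀ A T q d → (A ℤ.* (+ 1 ℤ.* q) ℤ.+ ℤ.- (+ 1 ℤ.* q ℤ.+ ℤ.- + 1 ℤ.* + 1) ℤ.* T) ℤ.* d ≡
    d ℤ.* (q ℤ.* A ℤ.+ T) ℤ.- d ℤ.* (q ℤ.* T)
  numerator = ℤSolver.solve-∀

  -numerator : ∀ A T q d → ℤ.- (A ℤ.* (+ 1 ℤ.* q) ℤ.+ ℤ.- (+ 1 ℤ.* q ℤ.+ ℤ.- + 1 ℤ.* + 1) ℤ.* T) ℤ.* d ≡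
    d ℤ.* (q ℤ.* T) ℤ.- d ℤ.* (q ℤ.* A ℤ.+ T)
  -numerator = ℤSolver.solve-∀

  castₘ : + (d * (q * A + T)) ≡ + d ℤ.* (+ q ℤ.* + A ℤ.+ + T)
  castₘ = trans (ℤ.pos-* d (q * A + T)) (cong (λ z → + d ℤ.* (z ℤ.+ + T)) (ℤ.pos-* q A))

  castₙ : + (d * (q * T)) ≡ + d ℤ.* (+ q ℤ.* + T)
  castₙ = trans (ℤ.pos-* d (q * T)) (cong (+ d ℤ.*_) (ℤ.pos-* q T))

  cancel : ∀ k l → k ℤ.+ l ℤ.- k ≡ l
  cancel = ℤSolver.solve-∀

  small : q * T ≤ suc n * (T * (1 * q))
  small = ≤-trans (≤-reflexive (trans (*-comm q T) (cong (T *_) (sym (+-identityʳ q)))))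
    (m≤m+n _ (n * (T * (1 * q))))

  bound : ∀ k l → k < l + q * T → + k ℤ.- + l ℤ.< ℚ.↥ ε ℤ.* ℚᵘ.↧ δᵘ
  bound k l k<l+qT = begin-strict
    + k ℤ.- + l                     <⟨ ℤ.+-monoˡ-< (ℤ.- (+ l)) (ℤ.+<+ k<l+qT) ⟩
    + (l + q * T) ℤ.- + l           ≡⟨ cancel (+ l) (+ (q * T)) ⟩
    + (q * T)                       ≤⟨ ℤ.+≤+ small ⟩
    + (suc n * (T * (1 * q)))       ∎
    where open ℤ.≤-Reasoning

  above′ : ℚᵘ.↥ δᵘ ℤ.* + d ℤ.< ℚ.↥ ε ℤ.* ℚᵘ.↧ δᵘ
  above′ = subst (ℤ._< ℚ.↥ ε ℤ.* ℚᵘ.↧ δᵘ)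
    (sym (trans (numerator (+ A) (+ T) (+ q) (+ d)) (cong₂ ℤ._-_ (sym castₘ) (sym castₙ))))
    (bound (d * (q * A + T)) (d * (q * T)) above)

  below′ : ℚᵘ.↥ (ℚᵘ.- δᵘ) ℤ.* + d ℤ.< ℚ.↥ ε ℤ.* ℚᵘ.↧ δᵘ
  below′ = subst (ℤ._< ℚ.↥ ε ℤ.* ℚᵘ.↧ δᵘ)
    (sym (trans (-numerator (+ A) (+ T) (+ q) (+ d)) (cong₂ ℤ._-_ (sym castₙ) (sym castₘ))))
    (bound (d * (q * T)) (d * (q * A + T)) below)

-- Atoms of arithmetic congruence monoids

unit⇒≡1 : ∀ {a b u} → Unit a b u → u ≡ 1
unit⇒≡1 {u = u} (_ , v , _ , uv≡1) = m*n≡1⇒m≡1 u v uv≡1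

nonUnit-class : ∀ {a b n} → NonUnit a b n → n ≡ a [mod b ]
nonUnit-class (inj₁ (_ , n≡a) , _)  = n≡a
nonUnit-class (inj₂ refl , ¬unit)   =
  contradiction (inj₂ refl , 1 , inj₂ refl , refl) ¬unit

-- Let b = q m and a = q c with c inverse to q modulo m.  The class of a modulo b
-- then consists of the multiples of q that are 1 modulo m.
module _ {a b q c m : ℕ} .{{_ : NonZero q}} .{{_ : NonZero m}} .{{_ : NonZero b}}
  (a≡qc : a ≡ q * c) (b≡qm : b ≡ q * m) (a²≡a : a * a ≡ a [mod b ])
  (qc≡1 : q * c ≡ 1 [mod m ]) where

  private
    instance
      qb≢0 : NonZero (q * b)
      qb≢0 = m*n≢0 q b

    q∣a : q ∣ a
    q∣a = subst (q ∣_) (sym a≡qc) (m∣m*n c)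

    q∣b : q ∣ b
    q∣b = subst (q ∣_) (sym b≡qm) (m∣m*n m)

    m⊥c : Coprime m c
    m⊥c {d} (d∣m , d∣c) = ∣1⇒≡1 (∣n∣m%n⇒∣m d∣m
      (subst (d ∣_) (mod⇒% {x = q * c} {1} qc≡1) (%-presˡ-∣ (∣n⇒∣m*n q d∣c) d∣m)))

    qqm≡qb : q * q * m ≡ q * b
    qqm≡qb = trans (*-assoc q q m) (cong (q *_) (sym b≡qm))

  factors⇒class : ∀ {n} → Factors a b n → n ≡ a * a [mod q * b ]
  factors⇒class (x , y , Nx , Ny , refl) = mod-trans (x * y) (x * a) (a * a)
    (∣-trans (*-monoˡ-∣ b q∣x) (mod-*ˡ x y a (nonUnit-class Ny)))
    (subst (λ z → z ≡ a * a [mod q * b ]) (*-comm a x)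
      (∣-trans (*-monoˡ-∣ b q∣a) (mod-*ˡ a x a (nonUnit-class Nx))))
    where
    q∣x : q ∣ x
    q∣x = mod-∣ x a (∣-trans q∣b (nonUnit-class Nx)) q∣a

  class⇒M : ∀ {n} → 1 ≤ n → n ≡ a * a [mod q * b ] → M a b n
  class⇒M {n} 1≤n n≡a² = inj₁ (1≤n , mod-trans n (a * a) a (∣-trans (n∣m*n q) n≡a²) a²≡a)

  class⇒q²∣ : ∀ {n} → n ≡ a * a [mod q * b ] → q * q ∣ n
  class⇒q²∣ {n} n≡a² = mod-∣ n (a * a)
    (∣-trans (subst (q * q ∣_) qqm≡qb (m∣m*n m)) n≡a²) (*-pres-∣ q∣a q∣a)

  multiple-nonUnit : ∀ e → 1 ≤ q * e → e ≡ c [mod m ] → q * e ≢ 1 → NonUnit a b (q * e)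
  multiple-nonUnit e 1≤qe e≡c qe≢1 = inj₁ (1≤qe ,
    subst₂ (λ x y → q * e ≡ x [mod y ]) (sym a≡qc) (sym b≡qm) (mod-*ˡ q e c e≡c)) ,
    (λ unit → qe≢1 (unit⇒≡1 unit))

  -- If f e is in the class of c * c and e in that of c, then so is f.
  cofactor-class : ∀ e f → q * q * (f * e) ≡ a * a [mod q * b ] → e ≡ c [mod m ] →
    f ≡ c [mod m ]
  cofactor-class e f q²fe≡a² e≡c = mod-coprime-cancelˡ c f c m⊥c
    (mod-trans (c * f) (f * e) (c * c) cf≡fe fe≡c²)
    where
    fe≡c² : f * e ≡ c * c [mod m ]
    fe≡c² = mod-*-cancelˡ (q * q) (f * e) (c * c) {{m*n≢0 q q}}
      (subst₂ (λ x y → q * q * (f * e) ≡ x [mod y ]) a²≡q²c² (sym qqm≡qb) q²fe≡a²)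
      where
      square : ∀ q c → q * c * (q * c) ≡ q * q * (c * c)
      square = solve-∀
      a²≡q²c² : a * a ≡ q * q * (c * c)
      a²≡q²c² = trans (cong₂ _*_ a≡qc a≡qc) (square q c)
    cf≡fe : c * f ≡ f * e [mod m ]
    cf≡fe = subst (λ z → z ≡ f * e [mod m ]) (*-comm f c)
      (∣-trans (n∣m*n f) (mod-*ˡ f c e (mod-sym e c e≡c)))

  splits⇒factors : ∀ {n} → 1 ≤ n → n ≡ a * a [mod q * b ] →
    (∀ k → n ≡ q * q * k → Splits q m c k) → Factors a b n
  splits⇒factors {n} 1≤n n≡a² splits with class⇒q²∣ n≡a²
  ... | divides k n≡kqq with splits k (trans n≡kqq (*-comm k (q * q)))
  ...   | e , f , refl , e≡c , qe≢1 , qf≢1 = q * e , q * f ,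
    multiple-nonUnit e (>-nonZero⁻¹ (q * e) {{m*n≢0⇒m≢0 (q * e) {{qeqf≢0}}}}) e≡c qe≢1 ,
    multiple-nonUnit f (>-nonZero⁻¹ (q * f) {{m*n≢0⇒n≢0 (q * e) {{qeqf≢0}}}}) f≡c qf≢1 ,
    n≡qeqf
    where
    rearrange : ∀ q e f → f * e * (q * q) ≡ q * e * (q * f)
    rearrange = solve-∀
    n≡qeqf : n ≡ q * e * (q * f)
    n≡qeqf = trans n≡kqq (rearrange q e f)
    qeqf≢0 : NonZero (q * e * (q * f))
    qeqf≢0 = >-nonZero (subst (1 ≤_) n≡qeqf 1≤n)
    f≡c : f ≡ c [mod m ]
    f≡c = cofactor-class e f (subst (λ z → z ≡ a * a [mod q * b ])
      (trans n≡kqq (*-comm (f * e) (q * q))) n≡a²) e≡c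

  M-cases : ∀ {n} → M a b n → Atom a b n ⊎ (n ≡ 1) ⊎ n ≡ a * a [mod q * b ]
  M-cases {n} Mn with Unit? a b n
  ... | yes unit = inj₂ (inj₁ (unit⇒≡1 unit))
  ... | no ¬unit with Factors? a b n
  ...   | yes factors = inj₂ (inj₂ (factors⇒class factors))
  ...   | no ¬factors = inj₁ ((Mn , ¬unit) , ¬factors)

  -- Let T, A and R count the elements of the monoid, the atoms, and the class
  -- of a * a modulo q b, up to x.
  module _ (x : ℕ) where

    private
      T A R : ℕ
      T = count (M? a b) x
      A = count (Atom? a b) x
      R = residueCount (q * b) (a * a) x

      one : ℕ
      one = ∑ x (λ i → 𝟙 (suc i ≟ 1))

      one≤1 : one ≤ 1
      one≤1 = ∑-atMostOne x 1 (λ i _ → 𝟙≤1 (suc i ≟ 1))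
        (λ {i} {j} i<j _ → inj₂ (𝟙-no (suc j ≟ 1) (λ { refl → n≮0 i<j })))

    T≤A+1+R : T ≤ A + (1 + R)
    T≤A+1+R = begin
      T                ≡⟨ count≡∑ (M? a b) x ⟩
      ∑ x (λ i → 𝟙 (M? a b (suc i)))
        ≤⟨ ∑-mono x (λ i _ → 𝟙-cases (M? a b (suc i)) (Atom? a b (suc i)) (suc i ≟ 1)
             (q * b ∣? ∣ suc i - a * a ∣) M-cases) ⟩
      ∑ x (λ i → 𝟙 (Atom? a b (suc i)) + (𝟙 (suc i ≟ 1) + 𝟙 (q * b ∣? ∣ suc i - a * a ∣)))
        ≡⟨ trans (∑-distrib-+ x _ _) (cong₂ _+_ (sym (count≡∑ (Atom? a b) x)) (∑-distrib-+ x _ _)) ⟩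
      A + (one + R)    ≤⟨ +-monoʳ-≤ A (+-monoˡ-≤ R one≤1) ⟩
      A + (1 + R)      ∎
      where open ≤-Reasoning

    A+R≤T+exceptions : ∀ E → (∀ n → 1 ≤ n → E n ≡ 0 → ∀ k → n ≡ q * q * k → Splits q m c k) →
      A + R ≤ T + ∑ x (E ∘ suc)
    A+R≤T+exceptions E splits = begin
      A + R            ≡⟨ cong (_+ R) (count≡∑ (Atom? a b) x) ⟩
      ∑ x (λ i → 𝟙 (Atom? a b (suc i))) + R   ≡⟨ ∑-distrib-+ x _ _ ⟨
      ∑ x (λ i → 𝟙 (Atom? a b (suc i)) + 𝟙 (q * b ∣? ∣ suc i - a * a ∣))
        ≤⟨ ∑-mono x (λ i _ → 𝟙-overlap (Atom? a b (suc i)) (q * b ∣? ∣ suc i - a * a ∣) (M? a b (suc i))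
             (λ ((Mn , _) , _) → Mn) (class⇒M (s≤s z≤n))
             (λ (_ , ¬factors) n≡a² E≡0 →
               ¬factors (splits⇒factors (s≤s z≤n) n≡a² (splits (suc i) (s≤s z≤n) E≡0)))) ⟩
      ∑ x (λ i → 𝟙 (M? a b (suc i)) + E (suc i))  ≡⟨ ∑-distrib-+ x _ _ ⟩
      ∑ x (λ i → 𝟙 (M? a b (suc i))) + ∑ x (E ∘ suc) ≡⟨ cong (_+ ∑ x (E ∘ suc)) (count≡∑ (M? a b) x) ⟨
      T + ∑ x (E ∘ suc) ∎
      where open ≤-Reasoning

    x≤bT+b : x ≤ b * T + b
    x≤bT+b = begin
      x                              ≤⟨ residueCount-≥ b a x ⟩
      b * residueCount b a x + b     ≤⟨ +-monoˡ-≤ b (*-monoʳ-≤ b (begin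
        residueCount b a x
          ≤⟨ ∑-mono x (λ i _ → 𝟙-mono (b ∣? ∣ suc i - a ∣) (M? a b (suc i))
               (λ n≡a → inj₁ (s≤s z≤n , n≡a))) ⟩
        ∑ x (λ i → 𝟙 (M? a b (suc i))) ≡⟨ count≡∑ (M? a b) x ⟨
        T                              ∎)) ⟩
      b * T + b                      ∎
      where open ≤-Reasoning

    bT≤x+2b : b * T ≤ x + 2 * b
    bT≤x+2b = begin
      b * T                              ≤⟨ *-monoʳ-≤ b (begin
        T                                  ≡⟨ count≡∑ (M? a b) x ⟩
        ∑ x (λ i → 𝟙 (M? a b (suc i)))
          ≤⟨ ∑-mono x (λ i _ → 𝟙-union (M? a b (suc i)) (b ∣? ∣ suc i - a ∣) (suc i ≟ 1)
               λ { (inj₁ (_ , n≡a)) → inj₁ n≡a ; (inj₂ n≡1) → inj₂ n≡1 }) ⟩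
        ∑ x (λ i → 𝟙 (b ∣? ∣ suc i - a ∣) + 𝟙 (suc i ≟ 1)) ≡⟨ ∑-distrib-+ x _ _ ⟩
        residueCount b a x + one           ≤⟨ +-monoʳ-≤ (residueCount b a x) one≤1 ⟩
        residueCount b a x + 1             ∎) ⟩
      b * (residueCount b a x + 1)       ≡⟨ *-distribˡ-+ b (residueCount b a x) 1 ⟩
      b * residueCount b a x + b * 1
        ≤⟨ +-mono-≤ (residueCount-≤ b a x) (≤-reflexive (*-identityʳ b)) ⟩
      (x + b) + b                        ≡⟨ double x b ⟩
      x + 2 * b                          ∎
      where
      open ≤-Reasoning
      double : ∀ x b → (x + b) + b ≡ x + 2 * b
      double = solve-∀

  -- With d the denominator of ε, exceptions up to x number at most x / (2 b d),
  -- about T / (2 d).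
  density-bound : ∀ ε → 0ℚ ℚ.< ε →
    AllBut1/ (2 * b * ℚ.↧ₙ ε) (λ n → ∀ k → n ≡ q * q * k → Splits q m c k) →
    ∃[ N ] (∀ n .{{_ : NonZero n}} → N ≤ n → ℚ.∣ atomRatio a b n - (1ℚ - (+ 1 / q)) ∣ ℚ.< ε)
  density-bound ε 0<ε (E , splits , N , E-small) =
    N + suc (6 * b * ℚ.↧ₙ ε + 2 * b) , λ x N≤x →
      let large = large-T (E-small x (m+n≤o⇒m≤o N N≤x)) (m+n≤o⇒n≤o N N≤x) (x≤bT+b x)
      in ratio-close (count (Atom? a b) x) (count (M? a b) x) q {{count-M-nonZero a b x}} ε 0<ε
        (few-atoms (A+R≤T+exceptions x E splits) (bT≤x+2b x) (residueCount-≥ (q * b) (a * a) x) large)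
        (few-nonatoms (T≤A+1+R x) (residueCount-≤ (q * b) (a * a) x) (x≤bT+b x) large)

  hasAtomicDensity : HasAtomicDensity a b (1ℚ - (+ 1 / q))
  hasAtomicDensity ε 0<ε = density-bound ε 0<ε
    (almostAll-quotient (q * q) {{m*n≢0 q q}} (almostAll-splits q m c qc≡1) (2 * b * ℚ.↧ₙ ε))

theorem1p1 : (a b : ℕ) (1≤a : 1 ≤ a) → a ≤ b → a ^ 2 ≡ a [mod b ] →
    HasAtomicDensity a b (1ℚ - _/_ (+ 1) (gcd a b) {{gcd-nonZero b 1≤a}})
theorem1p1 a b 1≤a a≤b a²≡a =
  hasAtomicDensity {{q≢0}} {{m≢0}} {{b≢0}} a≡qc b≡qm a*a≡a qc≡1
  where
  instance
    q≢0 : NonZero (gcd a b)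
    q≢0 = gcd-nonZero b 1≤a
    b≢0 : NonZero b
    b≢0 = >-nonZero (≤-trans 1≤a a≤b)
  q c m : ℕ
  q = gcd a b
  c = a ÷ q
  m = b ÷ q
  a≡qc : a ≡ q * c
  a≡qc = sym (m*[n/m]≡n (gcd[m,n]∣m a b))
  b≡qm : b ≡ q * m
  b≡qm = sym (m*[n/m]≡n (gcd[m,n]∣n a b))
  instance
    m≢0 : NonZero m
    m≢0 = m*n≢0⇒n≢0 q {{subst NonZero b≡qm b≢0}}
  a*a≡a : a * a ≡ a [mod b ]
  a*a≡a = subst (λ z → a * z ≡ a [mod b ]) (*-identityʳ a) a²≡a
  -- b divides a (a - 1), hence m divides c (a - 1), and m is coprime to c.
  qc≡1 : q * c ≡ 1 [mod m ]
  qc≡1 = mod-coprime-cancelˡ c (q * c) 1 (Coprimality.sym (coprime-/gcd a b))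
    (mod-*-cancelˡ q (c * (q * c)) (c * 1) (subst₂ (λ x y → x ≡ y [mod q * m ])
      (trans (cong₂ _*_ a≡qc a≡qc) (*-assoc q c (q * c)))
      (trans a≡qc (cong (q *_) (sym (*-identityʳ c))))
      (subst (λ z → a * a ≡ a [mod z ]) b≡qm a*a≡a)))
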